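{- Let $G$ be a graph and let $g,f:V(G)\rightarrow \mathbb{Z}^{+}$ be two integer-valued functions with $g(x)\leq f(x)$ for each $x\in V(G)$. Let $H$ be a subgraph of $G$. Then $G$ has all fractional $(g,f)$-factors excluding $H$ if and only if $$g(S)+\sum_{x\in T}d_{G-S}(x)-f(T)\geq\sum_{x\in T}d_H(x)-e_H(S,T)$$ for every subset $S$ of $V(G)$, where $T=\{x : x\in V(G)\setminus S,\ d_{G-S}(x)-d_H(x)+e_H(x,S)<f(x)\}$.
   Context: Graphs are finite, undirected, without loops or multiple edges. $\mathbb{Z}^{+}$ is the set of positive integers. $d_G(x)$ is the degree of $x$ in $G$; $G-S$ is the subgraph of $G$ induced by $V(G)\setminus S$. For a subgraph $H$ of $G$ and a vertex $x\in V(G)$, $d_H(x)$ is the number of edges of $H$ incident with $x$ (so it is $0$ if $x\notin V(H)$). For disjoint $S,T\subseteq V(G)$, $e_H(S,T)$ is the number of edges of $H$ with one end in $S$ and the other in $T$, and $e_H(x,S)=e_H(\{x\},S)$. For a function $\varphi$ on $V(G)$ and $X\subseteq V(G)$, $\varphi(X)=\sum_{x\in X}\varphi(x)$. For $r:V(G)\to\mathbb{Z}^{+}$, a function $h:E(G)\to[0,1]$ with $\sum_{e\in E(x)}h(e)=r(x)$ for every $x\in V(G)$, where $E(x)$ is the set of edges of $G$ incident with $x$, determines a fractional $r$-factor $F_h$ of $G$: the subgraph with vertex set $V(G)$ and edge set $E(F_h)=\{e\in E(G):h(e)>0\}$. $G$ has all fractional $(g,f)$-factors excluding $H$ if for every $r:V(G)\to\mathbb{Z}^{+}$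 with $g(x)\le r(x)\le f(x)$ for all $x\in V(G)$, $G$ has a fractional $r$-factor $F_h$ with $E(H)\cap E(F_h)=\emptyset$. -}

module Defs where

open import Algebra.Bundles.Raw using (RawMonoid)
import Algebra.Definitions.RawMonoid as RawSum
open import Data.Bool using (if_then_else_)
open import Data.Fin as Fin using (Fin)
import Data.Fin.Properties as Fin
open import Data.Fin.Subset using (Subset; _∈_; _∩_; ∁; ∣_∣; ⁅_⁆)
open import Data.Fin.Subset.Properties using (_∈?_)
open import Data.Integer as ℤ using (ℤ; +_)
import Data.Integer.Properties as ℤ
open import Data.Nat as ℕ using (ℕ)
import Data.Nat.Properties as ℕ
open import Data.Product using (_×_; _,_; proj₁; proj₂; ∃-syntax)
open import Data.Rational as ℚ using (ℚ; 0ℚ; 1ℚ; ½)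
import Data.Rational.Properties as ℚ
open import Data.Rational.Solver using (module +-*-Solver)
open import Data.Vec using (lookup; tabulate)
open import Data.Vec.Properties using (lookup∘tabulate; []=⇒lookup)
open import Function using (_∘_)
open import Function.Definitions using (Injective)
open import Level using (Level; 0ℓ)
open import Relation.Binary.PropositionalEquality
open import Relation.Nullary using (does; yes; no; ¬?)
open import Relation.Nullary.Decidable using (_×-dec_; _⊎-dec_)
open import Relation.Unary using (Pred; Decidable; Empty)
import Relation.Unary as Pred

private
  variable
    a ℓ : Level
    n : ℕ

-- The real numbers: Cauchy sequences of rationals, up to _≈ᴿ_.

record ℝ : Set where
  field
    seq    : ℕ → ℚ
    cauchy : ∀ ε → 0ℚ ℚ.< ε → ∃[ N ] ∀ i j → N ℕ.≤ i → N ℕ.≤ j →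
             ℚ.∣ seq i ℚ.- seq j ∣ ℚ.< ε

open ℝ

infix 4 _≈ᴿ_ _≤ᴿ_ _<ᴿ_
infixl 6 _+ᴿ_

_≈ᴿ_ : ℝ → ℝ → Set
x ≈ᴿ y = ∀ ε → 0ℚ ℚ.< ε → ∃[ N ] ∀ i → N ℕ.≤ i →
         ℚ.∣ seq x i ℚ.- seq y i ∣ ℚ.< ε

_≤ᴿ_ : ℝ → ℝ → Set
x ≤ᴿ y = ∀ ε → 0ℚ ℚ.< ε → ∃[ N ] ∀ i → N ℕ.≤ i →
         seq x i ℚ.< seq y i ℚ.+ ε

-- Strictness needs one rational gap valid for all large indices;
-- a termwise < would allow the limits to coincide.
_<ᴿ_ : ℝ → ℝ → Set
x <ᴿ y = ∃[ ε ] (0ℚ ℚ.< ε × ∃[ N ] ∀ i → N ℕ.≤ i →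
         seq x i ℚ.+ ε ℚ.< seq y i)

fromℚ : ℚ → ℝ
fromℚ q .seq _ = q
fromℚ q .cauchy ε 0<ε = 0 , λ _ _ _ _ →
  subst (ℚ._< ε) (sym (cong ℚ.∣_∣ (ℚ.+-inverseʳ q))) 0<ε

fromℕ : ℕ → ℝ
fromℕ k = fromℚ (+ k ℚ./ 1)

0ᴿ 1ᴿ : ℝ
0ᴿ = fromℚ 0ℚ
1ᴿ = fromℚ 1ℚ

_+ᴿ_ : ℝ → ℝ → ℝ
(x +ᴿ y) .seq i = seq x i ℚ.+ seq y i
(x +ᴿ y) .cauchy ε 0<ε = N₁ ℕ.⊔ N₂ , bound
  where
  δ = ½ ℚ.* ε

  0<δ : 0ℚ ℚ.< δ
  0<δ = subst (ℚ._< δ) (ℚ.*-zeroʳ ½) (ℚ.*-monoʳ-<-pos ½ 0<ε)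

  N₁ = proj₁ (cauchy x δ 0<δ)
  N₂ = proj₁ (cauchy y δ 0<δ)

  δ+δ≡ε : δ ℚ.+ δ ≡ ε
  δ+δ≡ε = trans (sym (ℚ.*-distribʳ-+ ε ½ ½)) (ℚ.*-identityˡ ε)

  interchange : ∀ p q r s →
    (p ℚ.+ q) ℚ.- (r ℚ.+ s) ≡ (p ℚ.- r) ℚ.+ (q ℚ.- s)
  interchange = solve 4 (λ p q r s →
    (p :+ q) :- (r :+ s) := (p :- r) :+ (q :- s)) refl
    where open +-*-Solver

  bound : ∀ i j → N₁ ℕ.⊔ N₂ ℕ.≤ i → N₁ ℕ.⊔ N₂ ℕ.≤ j →
    ℚ.∣ (seq x i ℚ.+ seq y i) ℚ.- (seq x j ℚ.+ seq y j) ∣ ℚ.< ε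
  bound i j N≤i N≤j = begin-strict
    ℚ.∣ (seq x i ℚ.+ seq y i) ℚ.- (seq x j ℚ.+ seq y j) ∣
      ≡⟨ cong ℚ.∣_∣ (interchange (seq x i) (seq y i) (seq x j) (seq y j)) ⟩
    ℚ.∣ (seq x i ℚ.- seq x j) ℚ.+ (seq y i ℚ.- seq y j) ∣
      ≤⟨ ℚ.∣p+q∣≤∣p∣+∣q∣ (seq x i ℚ.- seq x j) (seq y i ℚ.- seq y j) ⟩
    ℚ.∣ seq x i ℚ.- seq x j ∣ ℚ.+ ℚ.∣ seq y i ℚ.- seq y j ∣
      <⟨ ℚ.+-mono-<
           (proj₂ (cauchy x δ 0<δ) i j
             (ℕ.m⊔n≤o⇒m≤o N₁ N₂ N≤i) (ℕ.m⊔n≤o⇒m≤o N₁ N₂ N≤j))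
           (proj₂ (cauchy y δ 0<δ) i j
             (ℕ.m⊔n≤o⇒n≤o N₁ N₂ N≤i) (ℕ.m⊔n≤o⇒n≤o N₁ N₂ N≤j)) ⟩
    δ ℚ.+ δ
      ≡⟨ δ+δ≡ε ⟩
    ε ∎
    where open ℚ.≤-Reasoning

ℝ-+-0-rawMonoid : RawMonoid 0ℓ 0ℓ
ℝ-+-0-rawMonoid = record { _≈_ = _≈ᴿ_ ; _∙_ = _+ᴿ_ ; ε = 0ᴿ }

⟦_⟧ : {P : Pred (Fin n) ℓ} → Decidable P → Subset n
⟦ P? ⟧ = tabulate (does ∘ P?)

∈⟦⟧⁻ : {P : Pred (Fin n) ℓ} (P? : Decidable P) {x : Fin n} → x ∈ ⟦ P? ⟧ → P x
∈⟦⟧⁻ P? {x} x∈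
  with P? x | trans (sym (lookup∘tabulate (does ∘ P?) x)) ([]=⇒lookup x∈)
... | yes p | _ = p
... | no _  | ()

sumOver : (M : RawMonoid a ℓ) → Subset n →
          (Fin n → RawMonoid.Carrier M) → RawMonoid.Carrier M
sumOver M X φ = RawSum.sum M λ x → if lookup X x then φ x else RawMonoid.ε M

∑ℤ : Subset n → (Fin n → ℤ) → ℤ
∑ℤ = sumOver ℤ.+-0-rawMonoid

∑ℝ : Subset n → (Fin n → ℝ) → ℝ
∑ℝ = sumOver ℝ-+-0-rawMonoid

infix 5 ∑ℤ ∑ℝ
syntax ∑ℤ X (λ x → t) = ∑[ x ∈ X ] t
syntax ∑ℝ X (λ x → t) = ∑ᴿ[ x ∈ X ] t

-- An edge {x , y} is listed once, as the pair (x , y) with x < y: the strict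
-- order excludes loops, and injectivity of ends excludes multiple edges.
record Graph : Set where
  field
    order size : ℕ

  Vertex : Set
  Vertex = Fin order

  Edge : Set
  Edge = Fin size

  field
    ends    : Edge → Vertex × Vertex
    ordered : ∀ e → proj₁ (ends e) Fin.< proj₂ (ends e)
    simple  : Injective _≡_ _≡_ ends

  end₁ end₂ : Edge → Vertex
  end₁ = proj₁ ∘ ends
  end₂ = proj₂ ∘ ends

  -- E(x)
  edgesAt : Vertex → Subset size
  edgesAt x = ⟦ (λ e → (end₁ e Fin.≟ x) ⊎-dec (end₂ e Fin.≟ x)) ⟧

  edgesBetween : Subset order → Subset order → Subset size
  edgesBetween S T = ⟦ (λ e → ((end₁ e ∈? S) ×-dec (end₂ e ∈? T))
                        ⊎-dec ((end₁ e ∈? T) ×-dec (end₂ e ∈? S))) ⟧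

  edgesWithin : Subset order → Subset size
  edgesWithin X = ⟦ (λ e → (end₁ e ∈? X) ×-dec (end₂ e ∈? X)) ⟧

record Subgraph (G : Graph) : Set where
  open Graph G
  field
    vertices : Subset order
    edges    : Subset size
    closed   : ∀ {e} → e ∈ edges → end₁ e ∈ vertices × end₂ e ∈ vertices

module _ {G : Graph} where
  open Graph G

  -- d_H(x)
  degree : Subgraph G → Vertex → ℕ
  degree H x = ∣ Subgraph.edges H ∩ edgesAt x ∣

  -- e_H(S , T)
  between : Subgraph G → Subset order → Subset order → ℕ
  between H S T = ∣ Subgraph.edges H ∩ edgesBetween S T ∣

infixl 6 _∖_

_∖_ : (G : Graph) → Subset (Graph.order G) → Subgraph G
G ∖ S = record
  { vertices = ∁ S
  ; edges    = edgesWithin (∁ S)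
  ; closed   = ∈⟦⟧⁻ (λ e → (end₁ e ∈? ∁ S) ×-dec (end₂ e ∈? ∁ S))
  }
  where open Graph G

record FractionalFactor (G : Graph) (r : Graph.Vertex G → ℕ) : Set where
  open Graph G
  field
    h       : Edge → ℝ
    0≤h     : ∀ e → 0ᴿ ≤ᴿ h e
    h≤1     : ∀ e → h e ≤ᴿ 1ᴿ
    sum≈r   : ∀ x → (∑ᴿ[ e ∈ edgesAt x ] h e) ≈ᴿ fromℕ (r x)

  -- E(F_h), a predicate rather than a Subset because 0ᴿ <ᴿ_ is undecidable.
  support : Pred Edge 0ℓ
  support e = 0ᴿ <ᴿ h e

Positive : {A : Set} → (A → ℕ) → Set
Positive φ = ∀ x → 0 ℕ.< φ x

HasAllFractionalFactorsExcluding :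
  (G : Graph) (g f : Graph.Vertex G → ℕ) → Subgraph G → Set
HasAllFractionalFactorsExcluding G g f H =
  ∀ (r : Graph.Vertex G → ℕ) → Positive r →
  (∀ x → g x ℕ.≤ r x × r x ℕ.≤ f x) →
  ∃[ F ] Empty ((_∈ Subgraph.edges H) Pred.∩ FractionalFactor.support {G} {r} F)

deficientSet : (G : Graph) (f : Graph.Vertex G → ℕ) → Subgraph G →
               Subset (Graph.order G) → Subset (Graph.order G)
deficientSet G f H S = ⟦ (λ x →
  ¬? (x ∈? S) ×-dec
  (+ degree (G ∖ S) x ℤ.- + degree H x ℤ.+ + between H ⁅ x ⁆ S ℤ.<? + f x)) ⟧

{-# OPTIONS --safe #-}
module Submission where

-- Since T consists of the vertices outside S with negative contribution, the
-- condition says that f(T) ≤ g(S) + c(S,T) for all disjoint S and T, where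
-- c(S,T) is the sum over x ∈ T of the number of edges of G − E(H) from x to
-- vertices outside S.  For necessity take r = g on S and r = f elsewhere, and
-- count the weight at T edge by edge.  For sufficiency, replace every edge of
-- G − E(H) by its two arcs and look for a set of arcs with r(x) arcs leaving
-- and r(x) arcs entering each x; half the number of chosen arcs of an edge is
-- then a fractional r-factor.  Such a set exists by a Gale-type theorem: arcs
-- are decided one at a time, and two violated cuts that forbid both decisions
-- uncross.  Cuts (S,T) with S and T overlapping reduce to the disjoint case by
-- deleting S ∩ T from both.

open import Defs
open import Algebra.Bundles using (CommutativeMonoid)
import Algebra.Properties.CommutativeMonoid.Sum as CommSum
open import Data.Bool using (Bool; true; false; if_then_else_; _∧_; _∨_; not)
import Data.Bool.Properties as Bool
open import Data.Fin using (Fin; zero; suc; _↑ˡ_; _↑ʳ_; _≟_)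
import Data.Fin.Properties as Fin
open import Data.Fin.Subset using (Subset; _∈_; _∩_; _∪_; ∁; ⊤; ⊥; ⁅_⁆; ∣_∣)
open import Data.Fin.Subset.Properties using (anySubset?; _∈?_)
open import Data.Integer as ℤ using (ℤ; +_; 0ℤ; 1ℤ; _+_; _-_; _≥_)
import Data.Integer.Properties as ℤ
open import Data.Integer.Solver using (module +-*-Solver)
import Data.Nat.Coprimality as Coprime
open import Data.Nat as ℕ using (ℕ; zero; suc; _≤_)
import Data.Nat.Properties as ℕ
open import Data.Product using (_×_; _,_; proj₁; proj₂; ∃-syntax)
open import Data.Rational as ℚ using (ℚ; mkℚ; 0ℚ; 1ℚ; ½)
import Data.Rational.Properties as ℚ
import Data.Rational.Solver as ℚSolver
import Data.Rational.Unnormalised.Base as ℚᵘ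
import Data.Rational.Unnormalised.Properties as ℚᵘ
open import Data.Sum using (_⊎_; inj₁; inj₂)
open import Data.Vec using (lookup; []; _∷_)
open import Data.Vec.Functional as F using ()
open import Data.Vec.Functional.Properties using (lookup-++ˡ; lookup-++ʳ)
open import Data.Vec.Properties
  using (lookup-zipWith; lookup-map; lookup-replicate; lookup∘tabulate; lookup⇒[]=; []=⇒lookup)
open import Function using (_∘_)
open import Function.Bundles using (_⇔_; mk⇔)
open import Relation.Binary.PropositionalEquality as ≡ using (_≡_; _≢_; refl; cong; cong₂)
open import Relation.Nullary using (Dec; does; yes; no; ¬_; ¬?; contradiction)
open import Relation.Nullary.Decidable
  using (map′; _×-dec_; _→-dec_; from-yes; dec-true; dec-false)
open import Relation.Unary using (Decidable)

open ℝ

-- Lets `from-yes` settle an identity or inequality in finitely many Boolean variables by evaluating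
-- every assignment.
allBool? : ∀ {ℓ} {P : Bool → Set ℓ} → Decidable P → Dec (∀ b → P b)
allBool? P? = map′ (λ { (f , t) false → f ; (f , t) true → t })
                   (λ all → all false , all true) (P? false ×-dec P? true)

-- Finite sums over a commutative monoid

module Sums {a ℓ} (M : CommutativeMonoid a ℓ) where
  open CommutativeMonoid M
    renaming (_∙_ to infixl 6 _⊕_; ε to 0#; refl to ≈-refl; sym to ≈-sym; trans to ≈-trans)
  open CommSum M public

  infixr 7 _·_
  -- Unfolds to the conditional inside `sumOver`, so a sum over a subset `X` is definitionally the
  -- full sum of `lookup X x · φ x`.
  _·_ : Bool → Carrier → Carrier
  b · x = if b then x else 0#

  sum-δ : ∀ {n} (i : Fin n) (φ : Fin n → Carrier) →
          sum (λ j → does (i ≟ j) · φ j) ≈ φ i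
  sum-δ {suc n} zero φ = ≈-trans (∙-congˡ (sum-replicate-zero n)) (identityʳ (φ zero))
  sum-δ (suc i) φ = ≈-trans (identityˡ _) (sum-δ i (φ ∘ suc))

  -- An edge is seen from exactly two vertices: as its ends differ, the disjunction of the two tests
  -- is the sum of their indicators.
  sum-ends : ∀ {n} {u v : Fin n} → u ≢ v → (φ : Fin n → Carrier) →
             sum (λ x → (does (u ≟ x) ∨ does (v ≟ x)) · φ x) ≈ φ u ⊕ φ v
  sum-ends {u = u} {v} u≢v φ =
    ≈-trans (sum-cong-≋ λ x → split (u ≟ x) (v ≟ x))
    (≈-trans (∑-distrib-+ (λ x → does (u ≟ x) · φ x) (λ x → does (v ≟ x) · φ x))
             (∙-cong (sum-δ u φ) (sum-δ v φ)))
    where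
    split : ∀ {x} (a : Dec (u ≡ x)) (b : Dec (v ≡ x)) →
            (does a ∨ does b) · φ x ≈ does a · φ x ⊕ does b · φ x
    split (no _) b = ≈-sym (identityˡ _)
    split (yes _) (no _) = ≈-sym (identityʳ _)
    split (yes u≡x) (yes v≡x) = contradiction (≡.trans u≡x (≡.sym v≡x)) u≢v

  sum-↑ : ∀ m {n} (φ : Fin (m ℕ.+ n) → Carrier) →
          sum φ ≈ sum (φ ∘ (_↑ˡ n)) ⊕ sum (φ ∘ (m ↑ʳ_))
  sum-↑ zero φ = ≈-sym (identityˡ _)
  sum-↑ (suc m) φ = ≈-trans (∙-congˡ (sum-↑ m (φ ∘ suc))) (≈-sym (assoc _ _ _))

open Sums ℤ.+-0-commutativeMonoid
module Sumsℚ = Sums ℚ.+-0-commutativeMonoid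
open Sumsℚ using () renaming (sum to sumℚ; _·_ to _·ℚ_)

ι : Bool → ℤ
ι b = b · 1ℤ

sum-mono-≤ : ∀ {n} {φ ψ : Fin n → ℤ} → (∀ i → φ i ℤ.≤ ψ i) → sum φ ℤ.≤ sum ψ
sum-mono-≤ {zero} φ≤ψ = ℤ.≤-refl
sum-mono-≤ {suc n} φ≤ψ = ℤ.+-mono-≤ (φ≤ψ zero) (sum-mono-≤ (φ≤ψ ∘ suc))

∑-modular : ∀ {n} (X Y : Subset n) (φ : Fin n → ℤ) →
            ∑ℤ X φ + ∑ℤ Y φ ≡ ∑ℤ (X ∪ Y) φ + ∑ℤ (X ∩ Y) φ
∑-modular X Y φ = begin
  ∑ℤ X φ + ∑ℤ Y φ
    ≡⟨ ∑-distrib-+ (λ x → lookup X x · φ x) (λ x → lookup Y x · φ x) ⟨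
  sum (λ x → lookup X x · φ x + lookup Y x · φ x)
    ≡⟨ sum-cong-≗ pointwise ⟩
  sum (λ x → lookup (X ∪ Y) x · φ x + lookup (X ∩ Y) x · φ x)
    ≡⟨ ∑-distrib-+ (λ x → lookup (X ∪ Y) x · φ x) (λ x → lookup (X ∩ Y) x · φ x) ⟩
  ∑ℤ (X ∪ Y) φ + ∑ℤ (X ∩ Y) φ ∎
  where
  open ≡.≡-Reasoning
  bool : ∀ a b z → a · z + b · z ≡ (a ∨ b) · z + (a ∧ b) · z
  bool false b z = ℤ.+-comm 0ℤ (b · z)
  bool true false z = refl
  bool true true z = refl
  pointwise : ∀ x → lookup X x · φ x + lookup Y x · φ x ≡
                    lookup (X ∪ Y) x · φ x + lookup (X ∩ Y) x · φ x
  pointwise x rewrite lookup-zipWith _∨_ x X Y | lookup-zipWith _∧_ x X Y =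
    bool (lookup X x) (lookup Y x) (φ x)

-- Cuts in a directed graph and supermodularity of the excess

cross : Bool → Bool → Bool → ℤ
cross usable inX inY = ι (usable ∧ inX ∧ not inY)

-- Submodularity of a cut function, one arc at a time. Tails and heads are tested against separate
-- sets, as in the bipartite graph with an out-copy and an in-copy of every vertex.
cross-submodular : ∀ u x y x′ y′ →
  cross u (x ∨ x′) (y ∨ y′) + cross u (x ∧ x′) (y ∧ y′) ℤ.≤ cross u x y + cross u x′ y′
cross-submodular = from-yes
  (allBool? λ u → allBool? λ x → allBool? λ y → allBool? λ x′ → allBool? λ y′ →
    cross u (x ∨ x′) (y ∨ y′) + cross u (x ∧ x′) (y ∧ y′) ℤ.≤? cross u x y + cross u x′ y′)

-- Forbidden arcs are flagged instead of removed, so the two arcs of every edge keep their positions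
-- in the index set.
record Arcs (n k : ℕ) : Set where
  field
    usable    : Fin k → Bool
    tail head : Fin k → Fin n

  crossing : Subset n → Subset n → Fin k → ℤ
  crossing X Y a = cross (usable a) (lookup X (tail a)) (lookup Y (head a))

  -- A chosen arc with tail in `X` either has its head in `Y`, where at most `q` of `Y` arcs can
  -- end, or it crosses. A positive excess is thus an obstruction to out-degrees `p` and in-degrees
  -- `q`.
  excess : (p q : Fin n → ℤ) → Subset n → Subset n → ℤ
  excess p q X Y = ∑ℤ X p - ∑ℤ Y q - sum (crossing X Y)

  -- The demand terms are modular, and the submodular cut enters with a minus sign.
  excess-supermodular : ∀ p q X Y X′ Y′ →
    excess p q X Y + excess p q X′ Y′ ℤ.≤ excess p q (X ∪ X′) (Y ∪ Y′) + excess p q (X ∩ X′) (Y ∩ Y′)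
  excess-supermodular p q X Y X′ Y′ = begin
    (∑ℤ X p - ∑ℤ Y q - sum (crossing X Y)) + (∑ℤ X′ p - ∑ℤ Y′ q - sum (crossing X′ Y′))
      ≡⟨ regroup (∑ℤ X p) (∑ℤ Y q) _ (∑ℤ X′ p) (∑ℤ Y′ q) _ ⟩
    (∑ℤ X p + ∑ℤ X′ p) - (∑ℤ Y q + ∑ℤ Y′ q) - (sum (crossing X Y) + sum (crossing X′ Y′))
      ≤⟨ ℤ.+-mono-≤ (ℤ.≤-reflexive (cong₂ _-_ (∑-modular X X′ p) (∑-modular Y Y′ q)))
                    (ℤ.neg-mono-≤ cut) ⟩
    (∑ℤ (X ∪ X′) p + ∑ℤ (X ∩ X′) p) - (∑ℤ (Y ∪ Y′) q + ∑ℤ (Y ∩ Y′) q)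
      - (sum (crossing (X ∪ X′) (Y ∪ Y′)) + sum (crossing (X ∩ X′) (Y ∩ Y′)))
      ≡⟨ regroup (∑ℤ (X ∪ X′) p) (∑ℤ (Y ∪ Y′) q) _ (∑ℤ (X ∩ X′) p) (∑ℤ (Y ∩ Y′) q) _ ⟨
    excess p q (X ∪ X′) (Y ∪ Y′) + excess p q (X ∩ X′) (Y ∩ Y′) ∎
    where
    open ℤ.≤-Reasoning
    regroup : ∀ a b c a′ b′ c′ →
      (a - b - c) + (a′ - b′ - c′) ≡ (a + a′) - (b + b′) - (c + c′)
    regroup = solve 6 (λ a b c a′ b′ c′ →
      (a :- b :- c) :+ (a′ :- b′ :- c′) := (a :+ a′) :- (b :+ b′) :- (c :+ c′)) refl
      where open +-*-Solver
    pointwise : ∀ a → crossing (X ∪ X′) (Y ∪ Y′) a + crossing (X ∩ X′) (Y ∩ Y′) a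
                      ℤ.≤ crossing X Y a + crossing X′ Y′ a
    pointwise a rewrite lookup-zipWith _∨_ (tail a) X X′ | lookup-zipWith _∧_ (tail a) X X′
                      | lookup-zipWith _∨_ (head a) Y Y′ | lookup-zipWith _∧_ (head a) Y Y′ =
      cross-submodular (usable a) (lookup X (tail a)) (lookup Y (head a))
                                  (lookup X′ (tail a)) (lookup Y′ (head a))
    cut : sum (crossing (X ∪ X′) (Y ∪ Y′)) + sum (crossing (X ∩ X′) (Y ∩ Y′))
          ℤ.≤ sum (crossing X Y) + sum (crossing X′ Y′)
    cut = begin
      sum (crossing (X ∪ X′) (Y ∪ Y′)) + sum (crossing (X ∩ X′) (Y ∩ Y′))
        ≡⟨ ∑-distrib-+ (crossing (X ∪ X′) (Y ∪ Y′)) (crossing (X ∩ X′) (Y ∩ Y′)) ⟨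
      sum (λ a → crossing (X ∪ X′) (Y ∪ Y′) a + crossing (X ∩ X′) (Y ∩ Y′) a)
        ≤⟨ sum-mono-≤ pointwise ⟩
      sum (λ a → crossing X Y a + crossing X′ Y′ a)
        ≡⟨ ∑-distrib-+ (crossing X Y) (crossing X′ Y′) ⟩
      sum (crossing X Y) + sum (crossing X′ Y′) ∎

  Feasible : (p q : Fin n → ℤ) → Set
  Feasible p q = ∀ X Y → excess p q X Y ℤ.≤ 0ℤ

  -- A violating pair is found by searching the finitely many pairs of subsets. Integrality makes
  -- its excess at least 1, the unit that uncrossing adds up.
  feasible? : ∀ p q → Feasible p q ⊎ ∃[ X ] ∃[ Y ] 1ℤ ℤ.≤ excess p q X Y
  feasible? p q
    with anySubset? (λ X → anySubset? (λ Y → 1ℤ ℤ.≤? excess p q X Y))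
  ... | yes (X , Y , 1≤) = inj₂ (X , Y , 1≤)
  ... | no ¬∃ = inj₁ λ X Y → ℤ.≮⇒≥ λ 0< → ¬∃ (X , Y , ℤ.i<j⇒suc[i]≤j 0<)

open Arcs

-- Deciding the first arc

rest : ∀ {n k} → Arcs n (suc k) → Arcs n k
rest Γ = record { usable = usable Γ ∘ suc ; tail = tail Γ ∘ suc ; head = head Γ ∘ suc }

-- The demand that remains once an arc at `v` has been used.
lower : ∀ {n} → (Fin n → ℤ) → Fin n → Fin n → ℤ
lower p v x = p x - ι (does (v ≟ x))

∑-lower : ∀ {n} X (p : Fin n → ℤ) v → ∑ℤ X (lower p v) ≡ ∑ℤ X p - ι (lookup X v)
∑-lower X p v = begin
  ∑ℤ X (lower p v)
    ≡⟨ sum-cong-≗ (λ x → pointwise (lookup X x) (does (v ≟ x)) (p x)) ⟩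
  sum (λ x → lookup X x · p x + does (v ≟ x) · ℤ.- ι (lookup X x))
    ≡⟨ ∑-distrib-+ (λ x → lookup X x · p x) (λ x → does (v ≟ x) · ℤ.- ι (lookup X x)) ⟩
  ∑ℤ X p + sum (λ x → does (v ≟ x) · ℤ.- ι (lookup X x))
    ≡⟨ cong₂ _+_ {∑ℤ X p} refl (sum-δ v (λ x → ℤ.- ι (lookup X x))) ⟩
  ∑ℤ X p - ι (lookup X v) ∎
  where
  open ≡.≡-Reasoning
  pointwise : ∀ a b z → a · (z - ι b) ≡ a · z + b · ℤ.- ι a
  pointwise false false z = refl
  pointwise false true z = refl
  pointwise true false z = refl
  pointwise true true z = refl

module _ {n k} (Γ : Arcs n (suc k)) (p q : Fin n → ℤ) where

  private
    u = usable Γ zero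
    t = tail Γ zero
    h = head Γ zero

  excess-rest : ∀ X Y → excess Γ p q X Y ≡
    excess (rest Γ) p q X Y - cross u (lookup X t) (lookup Y h)
  excess-rest X Y = solve 3 (λ a b c → a :- (b :+ c) := a :- c :- b) refl
    (∑ℤ X p - ∑ℤ Y q) (cross u (lookup X t) (lookup Y h)) (sum (crossing (rest Γ) X Y))
    where open +-*-Solver

  -- Leaving out the first arc gives back to the excess exactly what that arc contributed to the
  -- cut.
  rest≤cross : Feasible Γ p q → ∀ X Y →
    excess (rest Γ) p q X Y ℤ.≤ cross u (lookup X t) (lookup Y h)
  rest≤cross feas X Y =
    ℤ.i-j≤0⇒i≤j (ℤ.≤-trans (ℤ.≤-reflexive (≡.sym (excess-rest X Y))) (feas X Y))

  excess-lower : ∀ X Y → excess (rest Γ) (lower p t) (lower q h) X Y ≡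
    excess (rest Γ) p q X Y - (ι (lookup X t) - ι (lookup Y h))
  excess-lower X Y rewrite ∑-lower X p t | ∑-lower Y q h =
    solve 5 (λ a b c d e → (a :- b) :- (c :- d) :- e := a :- c :- e :- (b :- d)) refl
      (∑ℤ X p) (ι (lookup X t)) (∑ℤ Y q) (ι (lookup Y h)) (sum (crossing (rest Γ) X Y))
    where open +-*-Solver

  -- If neither discarding nor using the first arc keeps the demands feasible,
  -- the violating pairs are crossed the wrong way round by that arc, so
  -- uncrossing them loses it from the cut.
  feasible-step : u ≡ true → Feasible Γ p q →
    Feasible (rest Γ) p q ⊎ Feasible (rest Γ) (lower p t) (lower q h)
  feasible-step u≡true feas
    with feasible? (rest Γ) p q | feasible? (rest Γ) (lower p t) (lower q h)
  ... | inj₁ ok | _ = inj₁ ok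
  ... | inj₂ _ | inj₁ ok = inj₂ ok
  ... | inj₂ (X , Y , 1≤e) | inj₂ (X′ , Y′ , 1≤e′) =
    contradiction (first , second , both)
      (uncrossing (lookup X t) (lookup Y h) (lookup X′ t) (lookup Y′ h))
    where
    open ℤ.≤-Reasoning
    E : Subset n → Subset n → ℤ
    E = excess (rest Γ) p q
    bound : ∀ X Y → E X Y ℤ.≤ cross true (lookup X t) (lookup Y h)
    bound X Y = ≡.subst (λ b → E X Y ℤ.≤ cross b (lookup X t) (lookup Y h)) u≡true (rest≤cross feas X Y)
    lowered : 1ℤ + (ι (lookup X′ t) - ι (lookup Y′ h)) ℤ.≤ E X′ Y′
    lowered = begin
      1ℤ + d          ≤⟨ ℤ.+-monoˡ-≤ d (ℤ.≤-trans 1≤e′ (ℤ.≤-reflexive (excess-lower X′ Y′))) ⟩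
      E X′ Y′ - d + d ≡⟨ solve 2 (λ a b → a :- b :+ b := a) refl (E X′ Y′) d ⟩
      E X′ Y′         ∎
      where
      d = ι (lookup X′ t) - ι (lookup Y′ h)
      open +-*-Solver
    first : 1ℤ ℤ.≤ cross true (lookup X t) (lookup Y h)
    first = ℤ.≤-trans 1≤e (bound X Y)
    second : 1ℤ + (ι (lookup X′ t) - ι (lookup Y′ h)) ℤ.≤ cross true (lookup X′ t) (lookup Y′ h)
    second = ℤ.≤-trans lowered (bound X′ Y′)
    both : 1ℤ + (1ℤ + (ι (lookup X′ t) - ι (lookup Y′ h))) ℤ.≤
      cross true (lookup X t ∨ lookup X′ t) (lookup Y h ∨ lookup Y′ h) +
      cross true (lookup X t ∧ lookup X′ t) (lookup Y h ∧ lookup Y′ h)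
    both = begin
      1ℤ + (1ℤ + (ι (lookup X′ t) - ι (lookup Y′ h)))
        ≤⟨ ℤ.+-mono-≤ 1≤e lowered ⟩
      E X Y + E X′ Y′
        ≤⟨ excess-supermodular (rest Γ) p q X Y X′ Y′ ⟩
      E (X ∪ X′) (Y ∪ Y′) + E (X ∩ X′) (Y ∩ Y′)
        ≤⟨ ℤ.+-mono-≤ (bound (X ∪ X′) (Y ∪ Y′)) (bound (X ∩ X′) (Y ∩ Y′)) ⟩
      cross true (lookup (X ∪ X′) t) (lookup (Y ∪ Y′) h) +
      cross true (lookup (X ∩ X′) t) (lookup (Y ∩ Y′) h)
        ≡⟨ cong₂ _+_ (cong₂ (cross true) (lookup-zipWith _∨_ t X X′) (lookup-zipWith _∨_ h Y Y′))
                     (cong₂ (cross true) (lookup-zipWith _∧_ t X X′) (lookup-zipWith _∧_ h Y Y′)) ⟩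
      cross true (lookup X t ∨ lookup X′ t) (lookup Y h ∨ lookup Y′ h) +
      cross true (lookup X t ∧ lookup X′ t) (lookup Y h ∧ lookup Y′ h) ∎
    -- The first inequality forces x = 1 and y = 0, the second x′ = 0 and y′ = 1. Then the arc
    -- crosses neither the union nor the intersection, and the third inequality reads 1 ≤ 0.
    uncrossing : ∀ x y x′ y′ →
      ¬ (1ℤ ℤ.≤ cross true x y × 1ℤ + (ι x′ - ι y′) ℤ.≤ cross true x′ y′ ×
         1ℤ + (1ℤ + (ι x′ - ι y′)) ℤ.≤
         cross true (x ∨ x′) (y ∨ y′) + cross true (x ∧ x′) (y ∧ y′))
    uncrossing = from-yes
      (allBool? λ x → allBool? λ y → allBool? λ x′ → allBool? λ y′ →
        ¬? (1ℤ ℤ.≤? cross true x y ×-dec 1ℤ + (ι x′ - ι y′) ℤ.≤? cross true x′ y′ ×-dec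
            1ℤ + (1ℤ + (ι x′ - ι y′)) ℤ.≤?
            cross true (x ∨ x′) (y ∨ y′) + cross true (x ∧ x′) (y ∧ y′)))

record Selection {n k} (Γ : Arcs n k) (p q : Fin n → ℤ) : Set where
  field
    chosen  : Fin k → Bool
    allowed : ∀ a → usable Γ a ≡ false → chosen a ≡ false
    out     : ∀ x → sum (λ a → ι (does (tail Γ a ≟ x) ∧ chosen a)) ≡ p x
    into    : ∀ x → sum (λ a → ι (does (head Γ a ≟ x) ∧ chosen a)) ≡ q x
open Selection

module _ {n k} {Γ : Arcs n (suc k)} {p q : Fin n → ℤ} where

  discardArc : Selection (rest Γ) p q → Selection Γ p q
  discardArc σ .chosen = false F.∷ chosen σ
  discardArc σ .allowed zero _ = refl
  discardArc σ .allowed (suc a) = allowed σ a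
  discardArc σ .out x rewrite Bool.∧-zeroʳ (does (tail Γ zero ≟ x)) =
    ≡.trans (ℤ.+-identityˡ _) (out σ x)
  discardArc σ .into x rewrite Bool.∧-zeroʳ (does (head Γ zero ≟ x)) =
    ≡.trans (ℤ.+-identityˡ _) (into σ x)

  useArc : usable Γ zero ≡ true →
    Selection (rest Γ) (lower p (tail Γ zero)) (lower q (head Γ zero)) → Selection Γ p q
  useArc u≡true σ .chosen = true F.∷ chosen σ
  useArc u≡true σ .allowed zero u≡false = contradiction (≡.trans (≡.sym u≡true) u≡false) λ ()
  useArc u≡true σ .allowed (suc a) = allowed σ a
  useArc u≡true σ .out x rewrite Bool.∧-identityʳ (does (tail Γ zero ≟ x)) | out σ x =
    solve 2 (λ a b → a :+ (b :- a) := b) refl (ι (does (tail Γ zero ≟ x))) (p x)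
    where open +-*-Solver
  useArc u≡true σ .into x rewrite Bool.∧-identityʳ (does (head Γ zero ≟ x)) | into σ x =
    solve 2 (λ a b → a :+ (b :- a) := b) refl (ι (does (head Γ zero ≟ x))) (q x)
    where open +-*-Solver

-- The Gale-type theorem: base case and induction

∑-⊤ : ∀ {n} (p : Fin n → ℤ) → ∑ℤ ⊤ p ≡ sum p
∑-⊤ p = sum-cong-≗ λ x → cong (_· p x) (lookup-replicate x true)

∑-⊥ : ∀ {n} (p : Fin n → ℤ) → ∑ℤ ⊥ p ≡ 0ℤ
∑-⊥ {n} p = ≡.trans (sum-cong-≗ {n = n} λ x → cong (_· p x) (lookup-replicate x false))
                    (sum-replicate-zero n)

does-≟-sym : ∀ {n} (x y : Fin n) → does (x ≟ y) ≡ does (y ≟ x)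
does-≟-sym zero zero = refl
does-≟-sym zero (suc y) = refl
does-≟-sym (suc x) zero = refl
does-≟-sym (suc x) (suc y) = does-≟-sym x y

lookup-⁅⁆ : ∀ {n} (x y : Fin n) → lookup ⁅ x ⁆ y ≡ does (y ≟ x)
lookup-⁅⁆ zero zero = refl
lookup-⁅⁆ zero (suc y) = lookup-replicate y false
lookup-⁅⁆ (suc x) zero = refl
lookup-⁅⁆ (suc x) (suc y) = lookup-⁅⁆ x y

∑-⁅⁆ : ∀ {n} x (p : Fin n → ℤ) → ∑ℤ ⁅ x ⁆ p ≡ p x
∑-⁅⁆ x p = ≡.trans
  (sum-cong-≗ λ y → cong (_· p y) (≡.trans (lookup-⁅⁆ x y) (does-≟-sym y x))) (sum-δ x p)

∑-∁ : ∀ {n} X (p : Fin n → ℤ) → ∑ℤ (∁ X) p ≡ sum p - ∑ℤ X p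
∑-∁ X p = begin
  ∑ℤ (∁ X) p
    ≡⟨ solve 2 (λ a b → a := b :+ a :- b) refl (∑ℤ (∁ X) p) (∑ℤ X p) ⟩
  ∑ℤ X p + ∑ℤ (∁ X) p - ∑ℤ X p
    ≡⟨ cong (_- ∑ℤ X p) (∑-distrib-+ (λ x → lookup X x · p x) (λ x → lookup (∁ X) x · p x)) ⟨
  sum (λ x → lookup X x · p x + lookup (∁ X) x · p x) - ∑ℤ X p
    ≡⟨ cong (_- ∑ℤ X p) (sum-cong-≗ pointwise) ⟩
  sum p - ∑ℤ X p ∎
  where
  open ≡.≡-Reasoning
  open +-*-Solver
  bool : ∀ b z → b · z + not b · z ≡ z
  bool false z = ℤ.+-identityˡ z
  bool true z = ℤ.+-identityʳ z
  pointwise : ∀ x → lookup X x · p x + lookup (∁ X) x · p x ≡ p x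
  pointwise x rewrite lookup-map x not X = bool (lookup X x) (p x)

-- Without arcs the excess is p(X) - q(Y). The singleton of x against the empty set gives p x ≤ 0;
-- its complement against the full set gives -p x ≤ 0, because the totals agree. The argument for
-- `q` is symmetric.
feasible⇒zero : ∀ {n} (Γ : Arcs n 0) (p q : Fin n → ℤ) → sum p ≡ sum q →
                Feasible Γ p q → ∀ x → p x ≡ 0ℤ × q x ≡ 0ℤ
feasible⇒zero Γ p q p≡q feas x =
  ℤ.≤-antisym (from (pq ⁅ x ⁆ ⊥ (∑-⁅⁆ x p) (∑-⊥ q)) (solve 1 (λ a → a :- con 0ℤ :- con 0ℤ := a) refl (p x)))
              (from⁻ (pq (∁ ⁅ x ⁆) ⊤ (co p) (∑-⊤ q))
                     (≡.trans (cong (λ z → sum p - p x - z - 0ℤ) (≡.sym p≡q))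
                       (solve 2 (λ s a → s :- a :- s :- con 0ℤ := :- a) refl (sum p) (p x)))) ,
  ℤ.≤-antisym (from (pq ⊤ (∁ ⁅ x ⁆) (∑-⊤ p) (co q))
                     (≡.trans (cong (λ z → z - (sum q - q x) - 0ℤ) p≡q)
                       (solve 2 (λ s a → s :- (s :- a) :- con 0ℤ := a) refl (sum q) (q x))))
              (from⁻ (pq ⊥ ⁅ x ⁆ (∑-⊥ p) (∑-⁅⁆ x q)) (solve 1 (λ a → con 0ℤ :- a :- con 0ℤ := :- a) refl (q x)))
  where
  open +-*-Solver
  co : ∀ r → ∑ℤ (∁ ⁅ x ⁆) r ≡ sum r - r x
  co r = ≡.trans (∑-∁ ⁅ x ⁆ r) (cong (sum r -_) (∑-⁅⁆ x r))
  pq : ∀ X Y {a b} → ∑ℤ X p ≡ a → ∑ℤ Y q ≡ b → a - b - 0ℤ ℤ.≤ 0ℤ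
  pq X Y refl refl = feas X Y
  from : ∀ {a b} → a ℤ.≤ 0ℤ → a ≡ b → b ℤ.≤ 0ℤ
  from a≤0 refl = a≤0
  from⁻ : ∀ {a b} → a ℤ.≤ 0ℤ → a ≡ ℤ.- b → 0ℤ ℤ.≤ b
  from⁻ {b = b} a≤0 refl = ≡.subst (0ℤ ℤ.≤_) (ℤ.neg-involutive b) (ℤ.neg-mono-≤ a≤0)

sum-lower : ∀ {n} (p : Fin n → ℤ) v → sum (lower p v) ≡ sum p - 1ℤ
sum-lower p v = begin
  sum (lower p v)        ≡⟨ ∑-⊤ (lower p v) ⟨
  ∑ℤ ⊤ (lower p v)       ≡⟨ ∑-lower ⊤ p v ⟩
  ∑ℤ ⊤ p - ι (lookup ⊤ v) ≡⟨ cong₂ (λ s b → s - ι b) (∑-⊤ p) (lookup-replicate v true) ⟩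
  sum p - 1ℤ             ∎
  where open ≡.≡-Reasoning

-- Induction on the number of arcs. Using an arc lowers both totals by 1, so they stay equal down to
-- the arcless case.
feasible⇒selection : ∀ {n k} (Γ : Arcs n k) (p q : Fin n → ℤ) → sum p ≡ sum q →
                     Feasible Γ p q → Selection Γ p q
feasible⇒selection {k = zero} Γ p q p≡q feas = record
  { chosen  = λ ()
  ; allowed = λ ()
  ; out     = λ x → ≡.sym (proj₁ (feasible⇒zero Γ p q p≡q feas x))
  ; into    = λ x → ≡.sym (proj₂ (feasible⇒zero Γ p q p≡q feas x))
  }
feasible⇒selection {k = suc k} Γ p q p≡q feas = byUsability (usable Γ zero) refl
  where
  byUsability : ∀ u → usable Γ zero ≡ u → Selection Γ p q
  -- An unusable arc crosses no cut, so the remaining arcs are already feasible.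
  byUsability false u≡ = discardArc (feasible⇒selection (rest Γ) p q p≡q λ X Y →
    ≡.subst (λ b → excess (rest Γ) p q X Y ℤ.≤
      cross b (lookup X (tail Γ zero)) (lookup Y (head Γ zero))) u≡ (rest≤cross Γ p q feas X Y))
  byUsability true u≡ with feasible-step Γ p q u≡ feas
  ... | inj₁ ok = discardArc (feasible⇒selection (rest Γ) p q p≡q ok)
  ... | inj₂ ok = useArc u≡ (feasible⇒selection (rest Γ) _ _
    (≡.trans (sum-lower p (tail Γ zero))
      (≡.trans (cong (_- 1ℤ) p≡q) (≡.sym (sum-lower q (head Γ zero))))) ok)

-- Indicators, cardinalities and linearity of sums

does-∈? : ∀ {n} x (X : Subset n) → does (x ∈? X) ≡ lookup X x
does-∈? zero (true ∷ X) = refl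
does-∈? zero (false ∷ X) = refl
does-∈? (suc x) (_ ∷ X) = does-∈? x X

+∣∣ : ∀ {n} (X : Subset n) → + ∣ X ∣ ≡ sum (λ x → ι (lookup X x))
+∣∣ [] = refl
+∣∣ (true ∷ X) = cong (λ z → 1ℤ + z) (+∣∣ X)
+∣∣ (false ∷ X) = ≡.trans (+∣∣ X) (≡.sym (ℤ.+-identityˡ _))

sum-neg : ∀ {k} (φ : Fin k → ℤ) → sum (λ i → ℤ.- φ i) ≡ ℤ.- sum φ
sum-neg {zero} φ = refl
sum-neg {suc k} φ = ≡.trans (cong (λ z → ℤ.- φ zero + z) (sum-neg (φ ∘ suc)))
                            (≡.sym (ℤ.neg-distrib-+ (φ zero) (sum (φ ∘ suc))))

∑-+ : ∀ {n} X (a b : Fin n → ℤ) → ∑ℤ X (λ x → a x + b x) ≡ ∑ℤ X a + ∑ℤ X b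
∑-+ X a b = ≡.trans (sum-cong-≗ λ x → pointwise (lookup X x))
                    (∑-distrib-+ (λ x → lookup X x · a x) (λ x → lookup X x · b x))
  where
  pointwise : ∀ k {i j} → k · (i + j) ≡ k · i + k · j
  pointwise true = refl
  pointwise false = refl

∑-minus : ∀ {n} X (a b : Fin n → ℤ) → ∑ℤ X a - ∑ℤ X b ≡ ∑ℤ X (λ x → a x - b x)
∑-minus X a b = begin
  ∑ℤ X a - ∑ℤ X b
    ≡⟨ cong (λ z → ∑ℤ X a + z) (sum-neg (λ x → lookup X x · b x)) ⟨
  ∑ℤ X a + sum (λ x → ℤ.- (lookup X x · b x))
    ≡⟨ cong (λ z → ∑ℤ X a + z) (sum-cong-≗ λ x → Bool.if-float ℤ.-_ (lookup X x)) ⟩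
  ∑ℤ X a + ∑ℤ X (λ x → ℤ.- b x)
    ≡⟨ ∑-+ X a (λ x → ℤ.- b x) ⟨
  ∑ℤ X (λ x → a x - b x) ∎
  where open ≡.≡-Reasoning

lookup-∩∁ : ∀ {n} (X Y : Subset n) x → lookup (X ∩ ∁ Y) x ≡ lookup X x ∧ not (lookup Y x)
lookup-∩∁ X Y x = ≡.trans (lookup-zipWith _∧_ x X (∁ Y))
                          (cong (λ b → lookup X x ∧ b) (lookup-map x not Y))

-- Stated in Boolean form so that it can serve as a premise in the decidable case tables.
Disjoint : ∀ {n} → Subset n → Subset n → Set
Disjoint S T = ∀ x → lookup S x ∧ lookup T x ≡ false

-- The condition of the theorem as a cut condition

module Excluding {G : Graph} (H : Subgraph G) where
  open Graph G

  u v : Edge → Vertex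
  u = end₁
  v = end₂

  inH : Edge → Bool
  inH = lookup (Subgraph.edges H)

  u≢v : ∀ e → u e ≢ v e
  u≢v e = Fin.<⇒≢ (ordered e)

  lookup-edgesAt : ∀ x e → lookup (edgesAt x) e ≡ does (u e ≟ x) ∨ does (v e ≟ x)
  lookup-edgesAt x e = lookup∘tabulate _ e

  lookup-edgesBetween : ∀ S T e → lookup (edgesBetween S T) e ≡
    (lookup S (u e) ∧ lookup T (v e)) ∨ (lookup T (u e) ∧ lookup S (v e))
  lookup-edgesBetween S T e = ≡.trans (lookup∘tabulate _ e)
    (cong₂ _∨_ (cong₂ _∧_ (does-∈? (u e) S) (does-∈? (v e) T))
               (cong₂ _∧_ (does-∈? (u e) T) (does-∈? (v e) S)))

  lookup-edgesWithin-∁ : ∀ S e →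
    lookup (edgesWithin (∁ S)) e ≡ not (lookup S (u e)) ∧ not (lookup S (v e))
  lookup-edgesWithin-∁ S e = ≡.trans (lookup∘tabulate _ e)
    (cong₂ _∧_ (≡.trans (does-∈? (u e) (∁ S)) (lookup-map (u e) not S))
               (≡.trans (does-∈? (v e) (∁ S)) (lookup-map (v e) not S)))

  -- The two flags given to `W` tell whether `x` is the first or the second end of the edge. Degrees
  -- and edge counts at a vertex all take this form.
  at : (Edge → Bool → Bool → Bool) → Vertex → Edge → Bool
  at W x e = W e (does (u e ≟ x)) (does (v e ≟ x))

  -- Double counting: after exchanging the sums, an edge contributes only at its two ends, since `W`
  -- vanishes when both flags are false. As there are no loops, exactly one flag is set at each end.
  ∑-by-edges : ∀ T (W : Edge → Bool → Bool → Bool) → (∀ e → W e false false ≡ false) →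
    ∑ℤ T (λ x → sum (λ e → ι (at W x e))) ≡
    sum (λ e → ι (lookup T (u e) ∧ W e true false) + ι (lookup T (v e) ∧ W e false true))
  ∑-by-edges T W W≡0 = begin
    ∑ℤ T (λ x → sum (λ e → ι (at W x e)))
      ≡⟨ sum-cong-≗ (λ x → push (lookup T x) (at W x)) ⟩
    sum (λ x → sum (λ e → ι (lookup T x ∧ at W x e)))
      ≡⟨ ∑-comm (λ x e → ι (lookup T x ∧ at W x e)) ⟩
    sum (λ e → sum (λ x → ι (lookup T x ∧ at W x e)))
      ≡⟨ sum-cong-≗ edge ⟩
    sum (λ e → ι (lookup T (u e) ∧ W e true false) + ι (lookup T (v e) ∧ W e false true)) ∎
    where
    open ≡.≡-Reasoning
    push : ∀ {k} b (w : Fin k → Bool) → b · sum (λ e → ι (w e)) ≡ sum (λ e → ι (b ∧ w e))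
    push true w = refl
    push {k} false w = ≡.sym (sum-replicate-zero k)
    φ : Edge → Vertex → ℤ
    φ e x = ι (lookup T x ∧ at W x e)
    absorb : ∀ t (w : Bool → Bool → Bool) a b → w false false ≡ false →
             ι (t ∧ w a b) ≡ (a ∨ b) · ι (t ∧ w a b)
    absorb t w false false w≡0 rewrite w≡0 | Bool.∧-zeroʳ t = refl
    absorb t w false true _ = refl
    absorb t w true b _ = refl
    edge : ∀ e → sum (φ e) ≡
      ι (lookup T (u e) ∧ W e true false) + ι (lookup T (v e) ∧ W e false true)
    edge e = begin
      sum (φ e)
        ≡⟨ sum-cong-≗ (λ x → absorb (lookup T x) (W e) (does (u e ≟ x)) (does (v e ≟ x)) (W≡0 e)) ⟩
      sum (λ x → (does (u e ≟ x) ∨ does (v e ≟ x)) · φ e x)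
        ≡⟨ sum-ends (u≢v e) (φ e) ⟩
      φ e (u e) + φ e (v e)
        ≡⟨ cong₂ (λ a b → ι (lookup T (u e) ∧ a) + ι (lookup T (v e) ∧ b))
             (cong₂ (W e) (dec-true (u e ≟ u e) refl) (dec-false (v e ≟ u e) (u≢v e ∘ ≡.sym)))
             (cong₂ (W e) (dec-false (u e ≟ v e) (u≢v e)) (dec-true (v e ≟ v e) refl)) ⟩
      ι (lookup T (u e) ∧ W e true false) + ι (lookup T (v e) ∧ W e false true) ∎

  degree-∖ : ∀ S x → + degree (G ∖ S) x ≡
    sum (λ e → ι (at (λ e a b → (not (lookup S (u e)) ∧ not (lookup S (v e))) ∧ (a ∨ b)) x e))
  degree-∖ S x = ≡.trans (+∣∣ (edgesWithin (∁ S) ∩ edgesAt x)) (sum-cong-≗ λ e → cong ι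
    (≡.trans (lookup-zipWith _∧_ e (edgesWithin (∁ S)) (edgesAt x))
             (cong₂ _∧_ (lookup-edgesWithin-∁ S e) (lookup-edgesAt x e))))

  degree-H : ∀ x → + degree H x ≡ sum (λ e → ι (at (λ e a b → inH e ∧ (a ∨ b)) x e))
  degree-H x = ≡.trans (+∣∣ (Subgraph.edges H ∩ edgesAt x)) (sum-cong-≗ λ e → cong ι
    (≡.trans (lookup-zipWith _∧_ e (Subgraph.edges H) (edgesAt x))
             (cong (λ b → inH e ∧ b) (lookup-edgesAt x e))))

  between-sum : ∀ S T → + between H S T ≡ sum (λ e → ι (inH e ∧
    ((lookup S (u e) ∧ lookup T (v e)) ∨ (lookup T (u e) ∧ lookup S (v e)))))
  between-sum S T = ≡.trans (+∣∣ (Subgraph.edges H ∩ edgesBetween S T)) (sum-cong-≗ λ e → cong ι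
    (≡.trans (lookup-zipWith _∧_ e (Subgraph.edges H) (edgesBetween S T))
             (cong (λ b → inH e ∧ b) (lookup-edgesBetween S T e))))

  between-⁅⁆ : ∀ S x → + between H ⁅ x ⁆ S ≡
    sum (λ e → ι (at (λ e a b → inH e ∧ ((a ∧ lookup S (v e)) ∨ (lookup S (u e) ∧ b))) x e))
  between-⁅⁆ S x = ≡.trans (between-sum ⁅ x ⁆ S) (sum-cong-≗ λ e → cong ι
    (cong₂ (λ a b → inH e ∧ ((a ∧ lookup S (v e)) ∨ (lookup S (u e) ∧ b)))
      (lookup-⁅⁆ x (u e)) (lookup-⁅⁆ x (v e))))

  -- Every edge is counted at its end in `T`; disjointness prevents it from being counted at both
  -- ends.
  ∑-between : ∀ S T → Disjoint S T → ∑ℤ T (λ x → + between H ⁅ x ⁆ S) ≡ + between H S T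
  ∑-between S T disj = begin
    ∑ℤ T (λ x → + between H ⁅ x ⁆ S)
      ≡⟨ sum-cong-≗ (λ x → cong (lookup T x ·_) (between-⁅⁆ S x)) ⟩
    ∑ℤ T (λ x → sum (λ e → ι (at W x e)))
      ≡⟨ ∑-by-edges T W (λ e → vanish (inH e) (lookup S (u e))) ⟩
    sum (λ e → ι (lookup T (u e) ∧ W e true false) + ι (lookup T (v e) ∧ W e false true))
      ≡⟨ sum-cong-≗ (λ e → edge (inH e) (lookup S (u e)) (lookup S (v e))
                             (lookup T (u e)) (lookup T (v e)) (disj (u e))) ⟩
    sum (λ e → ι (inH e ∧
      ((lookup S (u e) ∧ lookup T (v e)) ∨ (lookup T (u e) ∧ lookup S (v e)))))
      ≡⟨ between-sum S T ⟨
    + between H S T ∎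
    where
    open ≡.≡-Reasoning
    W : Edge → Bool → Bool → Bool
    W e a b = inH e ∧ ((a ∧ lookup S (v e)) ∨ (lookup S (u e) ∧ b))
    vanish : ∀ h s → h ∧ (false ∨ (s ∧ false)) ≡ false
    vanish = from-yes (allBool? λ h → allBool? λ s → h ∧ (false ∨ (s ∧ false)) Bool.≟ false)
    edge : ∀ h su sv tu tv → su ∧ tu ≡ false →
      ι (tu ∧ (h ∧ ((true ∧ sv) ∨ (su ∧ false)))) + ι (tv ∧ (h ∧ ((false ∧ sv) ∨ (su ∧ true))))
      ≡ ι (h ∧ ((su ∧ tv) ∨ (tu ∧ sv)))
    edge = from-yes (allBool? λ h → allBool? λ su → allBool? λ sv → allBool? λ tu → allBool? λ tv →
      (su ∧ tu Bool.≟ false) →-dec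
      (ι (tu ∧ (h ∧ ((true ∧ sv) ∨ (su ∧ false)))) + ι (tv ∧ (h ∧ ((false ∧ sv) ∨ (su ∧ true))))
       ℤ.≟ ι (h ∧ ((su ∧ tv) ∨ (tu ∧ sv)))))

  avail : Edge → Bool
  avail e = not (inH e)

  -- The c(S,T) of the header; an edge inside T counts twice.
  cut : Subset order → Subset order → ℤ
  cut S T = sum λ e → cross (avail e) (lookup T (u e)) (lookup S (v e)) +
                      cross (avail e) (lookup T (v e)) (lookup S (u e))

  -- The quantity that `deficientSet` compares with `f`. For `x` outside `S` it counts the edges of
  -- G - E(H) from `x` to vertices outside `S`.
  residual : Subset order → Vertex → ℤ
  residual S x = + degree (G ∖ S) x - + degree H x + + between H ⁅ x ⁆ S

  ∑-residual-parts : ∀ S T → ∑ℤ T (residual S) ≡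
    ∑ℤ T (λ x → + degree (G ∖ S) x) - ∑ℤ T (λ x → + degree H x) + ∑ℤ T (λ x → + between H ⁅ x ⁆ S)
  ∑-residual-parts S T = ≡.trans
    (∑-+ T (λ x → + degree (G ∖ S) x - + degree H x) (λ x → + between H ⁅ x ⁆ S))
    (cong (λ z → z + ∑ℤ T (λ x → + between H ⁅ x ⁆ S))
      (≡.sym (∑-minus T (λ x → + degree (G ∖ S) x) (λ x → + degree H x))))

  -- The degree in `H` also subtracts edges towards `S`, which G - S does not have; the `between`
  -- term restores precisely these. The identity is checked edge by edge, with disjointness used at
  -- both ends.
  ∑-residual : ∀ S T → Disjoint S T → ∑ℤ T (residual S) ≡ cut S T
  ∑-residual S T disj = begin
    ∑ℤ T (residual S)
      ≡⟨ ∑-residual-parts S T ⟩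
    ∑ℤ T (λ x → + degree (G ∖ S) x) - ∑ℤ T (λ x → + degree H x) + ∑ℤ T (λ x → + between H ⁅ x ⁆ S)
      ≡⟨ cong₂ _+_ (cong₂ _-_ (byEdges W₁ (degree-∖ S) (λ e → Bool.∧-zeroʳ _))
                              (byEdges W₂ degree-H (λ e → Bool.∧-zeroʳ (inH e))))
                   (≡.trans (∑-between S T disj) (between-sum S T)) ⟩
    sum e₁ - sum e₂ + sum e₃
      ≡⟨ cong (λ z → z - sum e₂ + sum e₃) (≡.trans (sum-cong-≗ edge) (∑-distrib-+ (λ e → c e + e₂ e) (λ e → ℤ.- e₃ e))) ⟩
    sum (λ e → c e + e₂ e) + sum (λ e → ℤ.- e₃ e) - sum e₂ + sum e₃
      ≡⟨ cong₂ (λ y z → y + z - sum e₂ + sum e₃) (∑-distrib-+ c e₂) (sum-neg e₃) ⟩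
    (sum c + sum e₂) + ℤ.- sum e₃ - sum e₂ + sum e₃
      ≡⟨ solve 3 (λ a b c → (a :+ b) :- c :- b :+ c := a) refl (sum c) (sum e₂) (sum e₃) ⟩
    cut S T ∎
    where
    open ≡.≡-Reasoning
    open +-*-Solver
    W₁ W₂ : Edge → Bool → Bool → Bool
    W₁ e a b = (not (lookup S (u e)) ∧ not (lookup S (v e))) ∧ (a ∨ b)
    W₂ e a b = inH e ∧ (a ∨ b)
    e₁ e₂ e₃ c : Edge → ℤ
    e₁ e = ι (lookup T (u e) ∧ W₁ e true false) + ι (lookup T (v e) ∧ W₁ e false true)
    e₂ e = ι (lookup T (u e) ∧ W₂ e true false) + ι (lookup T (v e) ∧ W₂ e false true)
    e₃ e = ι (inH e ∧ ((lookup S (u e) ∧ lookup T (v e)) ∨ (lookup T (u e) ∧ lookup S (v e))))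
    c e = cross (avail e) (lookup T (u e)) (lookup S (v e)) +
          cross (avail e) (lookup T (v e)) (lookup S (u e))
    byEdges : ∀ W {d : Vertex → ℤ} → (∀ x → d x ≡ sum (λ e → ι (at W x e))) →
      (∀ e → W e false false ≡ false) →
      ∑ℤ T d ≡ sum (λ e → ι (lookup T (u e) ∧ W e true false) + ι (lookup T (v e) ∧ W e false true))
    byEdges W d≡ W≡0 =
      ≡.trans (sum-cong-≗ (λ x → cong (lookup T x ·_) (d≡ x))) (∑-by-edges T W W≡0)
    table : ∀ h su sv tu tv → su ∧ tu ≡ false → sv ∧ tv ≡ false →
      ι (tu ∧ ((not su ∧ not sv) ∧ true)) + ι (tv ∧ ((not su ∧ not sv) ∧ true)) ≡
      cross (not h) tu sv + cross (not h) tv su + (ι (tu ∧ (h ∧ true)) + ι (tv ∧ (h ∧ true))) +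
      ℤ.- ι (h ∧ ((su ∧ tv) ∨ (tu ∧ sv)))
    table = from-yes (allBool? λ h → allBool? λ su → allBool? λ sv → allBool? λ tu → allBool? λ tv →
      (su ∧ tu Bool.≟ false) →-dec (sv ∧ tv Bool.≟ false) →-dec
      (ι (tu ∧ ((not su ∧ not sv) ∧ true)) + ι (tv ∧ ((not su ∧ not sv) ∧ true)) ℤ.≟
       cross (not h) tu sv + cross (not h) tv su + (ι (tu ∧ (h ∧ true)) + ι (tv ∧ (h ∧ true))) +
       ℤ.- ι (h ∧ ((su ∧ tv) ∨ (tu ∧ sv)))))
    edge : ∀ e → e₁ e ≡ c e + e₂ e + ℤ.- e₃ e
    edge e = table (inH e) (lookup S (u e)) (lookup S (v e)) (lookup T (u e)) (lookup T (v e))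
                   (disj (u e)) (disj (v e))

  T₀ : (Vertex → ℕ) → Subset order → Subset order
  T₀ f = deficientSet G f H

  Condition : (g f : Vertex → ℕ) → Subset order → Set
  Condition g f S = ∑ℤ (T₀ f S) (λ x → + degree H x) - + between H S (T₀ f S) ℤ.≤
    ∑ℤ S (λ x → + g x) + ∑ℤ (T₀ f S) (λ x → + degree (G ∖ S) x) - ∑ℤ (T₀ f S) (λ x → + f x)

  CutCondition : (g f : Vertex → ℕ) → Set
  CutCondition g f = ∀ S T → Disjoint S T →
    ∑ℤ T (λ x → + f x) ℤ.≤ ∑ℤ S (λ x → + g x) + cut S T

  lookup-deficient : ∀ f S x → lookup (T₀ f S) x ≡
    not (lookup S x) ∧ does (residual S x ℤ.<? + f x)
  lookup-deficient f S x = ≡.trans (lookup∘tabulate _ x)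
    (cong (λ b → not b ∧ does (residual S x ℤ.<? + f x)) (does-∈? x S))

  deficient-disjoint : ∀ f S → Disjoint S (T₀ f S)
  deficient-disjoint f S x rewrite lookup-deficient f S x with lookup S x
  ... | false = refl
  ... | true = refl

  -- `T₀ f S` consists of the vertices outside `S` whose term is negative, so no other set disjoint
  -- from `S` has a smaller sum.
  deficient-minimal : ∀ f S T → Disjoint S T →
    ∑ℤ (T₀ f S) (residual S) - ∑ℤ (T₀ f S) (λ x → + f x) ℤ.≤ ∑ℤ T (residual S) - ∑ℤ T (λ x → + f x)
  deficient-minimal f S T disj = begin
    ∑ℤ (T₀ f S) (residual S) - ∑ℤ (T₀ f S) (λ x → + f x)
      ≡⟨ ∑-minus (T₀ f S) (residual S) (λ x → + f x) ⟩
    ∑ℤ (T₀ f S) (λ x → residual S x - + f x)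
      ≤⟨ sum-mono-≤ pointwise ⟩
    ∑ℤ T (λ x → residual S x - + f x)
      ≡⟨ ∑-minus T (residual S) (λ x → + f x) ⟨
    ∑ℤ T (residual S) - ∑ℤ T (λ x → + f x) ∎
    where
    open ℤ.≤-Reasoning
    bound : ∀ {i j} s t (i<j : Dec (i ℤ.< j)) → s ∧ t ≡ false →
            (not s ∧ does i<j) · (i - j) ℤ.≤ t · (i - j)
    bound true false i<j _ = ℤ.≤-refl
    bound false false (yes i<j) _ = ℤ.i≤j⇒i-j≤0 (ℤ.<⇒≤ i<j)
    bound false true (yes _) _ = ℤ.≤-refl
    bound false false (no _) _ = ℤ.≤-refl
    bound false true (no i≮j) _ = ℤ.i≤j⇒0≤j-i (ℤ.≮⇒≥ i≮j)
    pointwise : ∀ x → lookup (T₀ f S) x · (residual S x - + f x) ℤ.≤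
                      lookup T x · (residual S x - + f x)
    pointwise x rewrite lookup-deficient f S x =
      bound (lookup S x) (lookup T x) (residual S x ℤ.<? + f x) (disj x)

  module _ (g f : Vertex → ℕ) (S : Subset order) where

    private
      a b c d e : ℤ
      a = ∑ℤ S (λ x → + g x)
      b = ∑ℤ (T₀ f S) (λ x → + degree (G ∖ S) x)
      c = ∑ℤ (T₀ f S) (λ x → + f x)
      d = ∑ℤ (T₀ f S) (λ x → + degree H x)
      e = + between H S (T₀ f S)

      slack : a + b - c - (d - e) ≡ a + (∑ℤ (T₀ f S) (residual S) - c)
      slack = ≡.trans
        (solve 5 (λ a b c d e → a :+ b :- c :- (d :- e) := a :+ (b :- d :+ e :- c)) refl a b c d e)
        (cong (λ z → a + (z - c)) (≡.sym (≡.trans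
          (∑-residual-parts S (T₀ f S))
          (cong (λ z → b - d + z) (∑-between S (T₀ f S) (deficient-disjoint f S))))))
        where open +-*-Solver

    condition⇒slack : Condition g f S → 0ℤ ℤ.≤ a + (∑ℤ (T₀ f S) (residual S) - c)
    condition⇒slack cond = ≡.subst (0ℤ ℤ.≤_) slack (ℤ.i≤j⇒0≤j-i cond)

    slack⇒condition : 0ℤ ℤ.≤ a + (∑ℤ (T₀ f S) (residual S) - c) → Condition g f S
    slack⇒condition 0≤ = ℤ.0≤i-j⇒j≤i (≡.subst (0ℤ ℤ.≤_) (≡.sym slack) 0≤)

  -- The inequality at `T₀ f S` is the strongest one for a given `S`, by minimality.
  condition⇒cutCondition : ∀ g f → (∀ S → Condition g f S) → CutCondition g f
  condition⇒cutCondition g f cond S T disj = ℤ.0≤i-j⇒j≤i (begin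
    0ℤ
      ≤⟨ condition⇒slack g f S (cond S) ⟩
    ∑ℤ S (λ x → + g x) + (∑ℤ (T₀ f S) (residual S) - ∑ℤ (T₀ f S) (λ x → + f x))
      ≤⟨ ℤ.+-monoʳ-≤ (∑ℤ S (λ x → + g x)) (deficient-minimal f S T disj) ⟩
    ∑ℤ S (λ x → + g x) + (∑ℤ T (residual S) - ∑ℤ T (λ x → + f x))
      ≡⟨ cong (λ z → ∑ℤ S (λ x → + g x) + (z - ∑ℤ T (λ x → + f x))) (∑-residual S T disj) ⟩
    ∑ℤ S (λ x → + g x) + (cut S T - ∑ℤ T (λ x → + f x))
      ≡⟨ ℤ.+-assoc (∑ℤ S (λ x → + g x)) (cut S T) (ℤ.- ∑ℤ T (λ x → + f x)) ⟨
    ∑ℤ S (λ x → + g x) + cut S T - ∑ℤ T (λ x → + f x) ∎)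
    where open ℤ.≤-Reasoning

  cutCondition⇒condition : ∀ g f → CutCondition g f → ∀ S → Condition g f S
  cutCondition⇒condition g f cond S = slack⇒condition g f S (begin
    0ℤ
      ≤⟨ ℤ.i≤j⇒0≤j-i (cond S (T₀ f S) disj) ⟩
    ∑ℤ S (λ x → + g x) + cut S (T₀ f S) - ∑ℤ (T₀ f S) (λ x → + f x)
      ≡⟨ ℤ.+-assoc (∑ℤ S (λ x → + g x)) (cut S (T₀ f S)) (ℤ.- ∑ℤ (T₀ f S) (λ x → + f x)) ⟩
    ∑ℤ S (λ x → + g x) + (cut S (T₀ f S) - ∑ℤ (T₀ f S) (λ x → + f x))
      ≡⟨ cong (λ z → ∑ℤ S (λ x → + g x) + (z - ∑ℤ (T₀ f S) (λ x → + f x))) (∑-residual S (T₀ f S) disj) ⟨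
    ∑ℤ S (λ x → + g x) + (∑ℤ (T₀ f S) (residual S) - ∑ℤ (T₀ f S) (λ x → + f x)) ∎)
    where
    open ℤ.≤-Reasoning
    disj = deficient-disjoint f S

-- Integers in ℚ and eventual comparison of rational sequences

cast : ℤ → ℚ
cast z = z ℚ./ 1

-- The same rational as `cast z` in already reduced form, so that numerator and denominator compute.
int : ℤ → ℚ
int z = mkℚ z 0 (Coprime.sym (Coprime.1-coprimeTo ℤ.∣ z ∣))

cast≡int : ∀ z → cast z ≡ int z
cast≡int z = ℚ.↥p/↧p≡p (int z)

cast-+ : ∀ a b → cast (a + b) ≡ cast a ℚ.+ cast b
cast-+ a b rewrite cast≡int a | cast≡int b | cast≡int (a + b) =
  ℚ.toℚᵘ-injective (ℚᵘ.≃-trans (ℚᵘ.*≡* (solve 2 (λ a b → (a :+ b) :* con 1ℤ := (a :* con 1ℤ :+ b :* con 1ℤ) :* con 1ℤ) refl a b))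
    (ℚᵘ.≃-sym (ℚ.toℚᵘ-homo-+ (int a) (int b))))
  where open +-*-Solver

cast-cancel-< : ∀ {a b} → cast a ℚ.< cast b → a ℤ.< b
cast-cancel-< {a} {b} p rewrite cast≡int a | cast≡int b with p
... | ℚ.*<* q = ≡.subst₂ ℤ._<_ (ℤ.*-identityʳ a) (ℤ.*-identityʳ b) q

cast-sum : ∀ {n} (φ : Fin n → ℤ) → cast (sum φ) ≡ sumℚ (cast ∘ φ)
cast-sum {zero} φ = refl
cast-sum {suc n} φ = ≡.trans (cast-+ (φ zero) (sum (φ ∘ suc)))
                             (cong (λ z → cast (φ zero) ℚ.+ z) (cast-sum (φ ∘ suc)))

seq-∑ℝ : ∀ {n} (X : Subset n) (ρ : Fin n → ℝ) i →
         seq (∑ℝ X ρ) i ≡ sumℚ (λ x → lookup X x ·ℚ seq (ρ x) i)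
seq-∑ℝ X ρ i = ≡.trans (seq-sum (λ x → if lookup X x then ρ x else 0ᴿ))
  (Sumsℚ.sum-cong-≗ λ x → Bool.if-float (λ z → seq z i) (lookup X x))
  where
  open import Algebra.Definitions.RawMonoid ℝ-+-0-rawMonoid using () renaming (sum to sumℝ)
  seq-sum : ∀ {n} (ρ : Fin n → ℝ) → seq (sumℝ ρ) i ≡ sumℚ (λ x → seq (ρ x) i)
  seq-sum {zero} ρ = refl
  seq-sum {suc n} ρ = cong (λ z → seq (ρ zero) i ℚ.+ z) (seq-sum (ρ ∘ suc))

-- _≤ᴿ_ does not use the Cauchy property, so the estimates below compare bare
-- rational sequences, whose finite sums are rearranged termwise in ℚ.
infix 4 _≲_
record _≲_ (a b : ℕ → ℚ) : Set where
  constructor mk≲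
  field eventually : ∀ ε → 0ℚ ℚ.< ε → ∃[ N ] ∀ i → N ℕ.≤ i → a i ℚ.< b i ℚ.+ ε
open _≲_

half : ∀ ε → 0ℚ ℚ.< ε → 0ℚ ℚ.< ½ ℚ.* ε
half ε 0<ε = ≡.subst (ℚ._< ½ ℚ.* ε) (ℚ.*-zeroʳ ½) (ℚ.*-monoʳ-<-pos ½ 0<ε)

½+½ : ∀ ε → ½ ℚ.* ε ℚ.+ ½ ℚ.* ε ≡ ε
½+½ ε = ≡.trans (≡.sym (ℚ.*-distribʳ-+ ε ½ ½)) (ℚ.*-identityˡ ε)

≤⇒≲ : ∀ {a b} → (∀ i → a i ℚ.≤ b i) → a ≲ b
≤⇒≲ {a} {b} a≤b .eventually ε 0<ε = 0 , λ i _ →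
  ≡.subst (ℚ._< b i ℚ.+ ε) (ℚ.+-identityʳ (a i)) (ℚ.+-mono-≤-< (a≤b i) 0<ε)

≲-+ : ∀ {a b c d} → a ≲ b → c ≲ d → (λ i → a i ℚ.+ c i) ≲ (λ i → b i ℚ.+ d i)
≲-+ {a} {b} {c} {d} (mk≲ a≲b) (mk≲ c≲d) .eventually ε 0<ε
  with N , P ← a≲b (½ ℚ.* ε) (half ε 0<ε) | M , Q ← c≲d (½ ℚ.* ε) (half ε 0<ε) =
  N ℕ.⊔ M , λ i ≤i → begin-strict
    a i ℚ.+ c i
      <⟨ ℚ.+-mono-< (P i (ℕ.m⊔n≤o⇒m≤o N M ≤i)) (Q i (ℕ.m⊔n≤o⇒n≤o N M ≤i)) ⟩
    (b i ℚ.+ ½ ℚ.* ε) ℚ.+ (d i ℚ.+ ½ ℚ.* ε)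
      ≡⟨ solve 3 (λ b d e → (b :+ e) :+ (d :+ e) := b :+ d :+ (e :+ e)) refl (b i) (d i) (½ ℚ.* ε) ⟩
    b i ℚ.+ d i ℚ.+ (½ ℚ.* ε ℚ.+ ½ ℚ.* ε)
      ≡⟨ cong (λ z → b i ℚ.+ d i ℚ.+ z) (½+½ ε) ⟩
    b i ℚ.+ d i ℚ.+ ε ∎
  where
  open ℚ.≤-Reasoning
  open ℚSolver.+-*-Solver

≲-trans : ∀ {a b c} → a ≲ b → b ≲ c → a ≲ c
≲-trans {a} {b} {c} (mk≲ a≲b) (mk≲ b≲c) .eventually ε 0<ε
  with N , P ← a≲b (½ ℚ.* ε) (half ε 0<ε) | M , Q ← b≲c (½ ℚ.* ε) (half ε 0<ε) =
  N ℕ.⊔ M , λ i ≤i → begin-strict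
    a i
      <⟨ P i (ℕ.m⊔n≤o⇒m≤o N M ≤i) ⟩
    b i ℚ.+ ½ ℚ.* ε
      <⟨ ℚ.+-monoˡ-< (½ ℚ.* ε) (Q i (ℕ.m⊔n≤o⇒n≤o N M ≤i)) ⟩
    c i ℚ.+ ½ ℚ.* ε ℚ.+ ½ ℚ.* ε
      ≡⟨ ℚ.+-assoc (c i) (½ ℚ.* ε) (½ ℚ.* ε) ⟩
    c i ℚ.+ (½ ℚ.* ε ℚ.+ ½ ℚ.* ε)
      ≡⟨ cong (λ z → c i ℚ.+ z) (½+½ ε) ⟩
    c i ℚ.+ ε ∎
  where open ℚ.≤-Reasoning

≡⇒≲ : ∀ {a b} → (∀ i → a i ≡ b i) → a ≲ b
≡⇒≲ a≡b = ≤⇒≲ λ i → ℚ.≤-reflexive (a≡b i)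

≲-sum : ∀ {n} {a b : Fin n → ℕ → ℚ} → (∀ x → a x ≲ b x) →
        (λ i → sumℚ (λ x → a x i)) ≲ (λ i → sumℚ (λ x → b x i))
≲-sum {zero} a≲b = ≤⇒≲ λ _ → ℚ.≤-refl
≲-sum {suc n} a≲b = ≲-+ (a≲b zero) (≲-sum (a≲b ∘ suc))

∣p-q∣<ε⇒p<q+ε : ∀ {ε} p q → ℚ.∣ p ℚ.- q ∣ ℚ.< ε → p ℚ.< q ℚ.+ ε
∣p-q∣<ε⇒p<q+ε {ε} p q lt = ≡.subst (ℚ._< q ℚ.+ ε)
  (solve 2 (λ p q → q :+ (p :- q) := p) refl p q)
  (ℚ.+-monoʳ-< q (ℚ.≤-<-trans (p≤∣p∣ (p ℚ.- q)) lt))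
  where
  open ℚSolver.+-*-Solver
  p≤∣p∣ : ∀ p → p ℚ.≤ ℚ.∣ p ∣
  p≤∣p∣ p with ℚ.≤-total 0ℚ p
  ... | inj₁ 0≤p = ℚ.≤-reflexive (≡.sym (ℚ.0≤p⇒∣p∣≡p 0≤p))
  ... | inj₂ p≤0 = ℚ.≤-trans p≤0 (ℚ.0≤∣p∣ p)

≈ᴿ⇒≲ : ∀ {x y} → x ≈ᴿ y → seq x ≲ seq y × seq y ≲ seq x
≈ᴿ⇒≲ {x} {y} x≈y = mk≲ (λ ε 0<ε → proj₁ (x≈y ε 0<ε) , λ i ≤i →
    ∣p-q∣<ε⇒p<q+ε (seq x i) (seq y i) (proj₂ (x≈y ε 0<ε) i ≤i)) ,
  mk≲ (λ ε 0<ε → proj₁ (x≈y ε 0<ε) , λ i ≤i →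
    ∣p-q∣<ε⇒p<q+ε (seq y i) (seq x i)
      (≡.subst (ℚ._< ε) (swap (seq x i) (seq y i)) (proj₂ (x≈y ε 0<ε) i ≤i)))
  where
  open ℚSolver.+-*-Solver
  swap : ∀ p q → ℚ.∣ p ℚ.- q ∣ ≡ ℚ.∣ q ℚ.- p ∣
  swap p q = ≡.trans (≡.sym (ℚ.∣-p∣≡∣p∣ (p ℚ.- q)))
    (cong ℚ.∣_∣ (solve 2 (λ p q → :- (p :- q) := q :- p) refl p q))

-- Here the Cauchy property matters. If one term past `N` were at least ε, all terms past `N` would
-- exceed ε/2, and the gap ε/4 would witness that `x` is positive.
≮0⇒≲0 : ∀ x → ¬ (0ᴿ <ᴿ x) → seq x ≲ (λ _ → 0ℚ)
≮0⇒≲0 x ¬0<x .eventually ε 0<ε with N , C ← cauchy x (½ ℚ.* ε) (half ε 0<ε) = N , λ i ≤i →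
  ℚ.≰⇒> λ ε≤xᵢ → ¬0<x (¼ε , 0<¼ε , N , λ j ≤j → begin-strict
    0ℚ ℚ.+ ¼ε      ≡⟨ ℚ.+-identityˡ ¼ε ⟩
    ¼ε             <⟨ ¼ε<½ε ⟩
    ½ ℚ.* ε        ≡⟨ ½ε≡ ⟩
    ε ℚ.- ½ ℚ.* ε  ≤⟨ ℚ.+-monoˡ-≤ (ℚ.- (½ ℚ.* ε)) (≡.subst (ℚ._≤ seq x i) (ℚ.+-identityˡ ε) ε≤xᵢ) ⟩
    seq x i ℚ.- ½ ℚ.* ε
      <⟨ ℚ.+-monoˡ-< (ℚ.- (½ ℚ.* ε)) (∣p-q∣<ε⇒p<q+ε (seq x i) (seq x j) (C i j ≤i ≤j)) ⟩
    seq x j ℚ.+ ½ ℚ.* ε ℚ.- ½ ℚ.* ε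
      ≡⟨ solve 2 (λ a b → a :+ b :- b := a) refl (seq x j) (½ ℚ.* ε) ⟩
    seq x j ∎)
  where
  open ℚ.≤-Reasoning
  open ℚSolver.+-*-Solver
  ¼ε : ℚ
  ¼ε = ½ ℚ.* (½ ℚ.* ε)
  0<¼ε : 0ℚ ℚ.< ¼ε
  0<¼ε = half (½ ℚ.* ε) (half ε 0<ε)
  ¼ε<½ε : ¼ε ℚ.< ½ ℚ.* ε
  ¼ε<½ε = begin-strict
    ¼ε           ≡⟨ ℚ.+-identityʳ ¼ε ⟨
    ¼ε ℚ.+ 0ℚ    <⟨ ℚ.+-monoʳ-< ¼ε 0<¼ε ⟩
    ¼ε ℚ.+ ¼ε    ≡⟨ ½+½ (½ ℚ.* ε) ⟩
    ½ ℚ.* ε      ∎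
  ½ε≡ : ½ ℚ.* ε ≡ ε ℚ.- ½ ℚ.* ε
  ½ε≡ = ≡.trans (solve 1 (λ a → a := a :+ a :- a) refl (½ ℚ.* ε)) (cong (ℚ._- ½ ℚ.* ε) (½+½ ε))

-- Tolerance 1 yields a < b + 1, which for integers is a ≤ b. This recovers an exact inequality from
-- limits.
cast-cancel-≲ : ∀ {a b} → (λ _ → cast a) ≲ (λ _ → cast b) → a ℤ.≤ b
cast-cancel-≲ {a} {b} (mk≲ a≲b) with N , P ← a≲b 1ℚ (ℚ.positive⁻¹ 1ℚ) =
  ℤ.≮⇒≥ λ b<a → ℤ.<⇒≱ (≡.subst (a ℤ.<_) (ℤ.+-comm b 1ℤ)
    (cast-cancel-< (≡.subst (cast a ℚ.<_) (≡.sym (cast-+ b 1ℤ)) (P N ℕ.≤-refl))))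
    (ℤ.i<j⇒suc[i]≤j b<a)

cast-· : ∀ b z → cast (b · z) ≡ b ·ℚ cast z
cast-· b z = Bool.if-float cast b

cast-∑ : ∀ {n} (X : Subset n) (φ : Fin n → ℤ) →
         cast (∑ℤ X φ) ≡ sumℚ (λ x → lookup X x ·ℚ cast (φ x))
cast-∑ X φ = ≡.trans (cast-sum (λ x → lookup X x · φ x))
                     (Sumsℚ.sum-cong-≗ λ x → cast-· (lookup X x) (φ x))

≲-· : ∀ b {a a′} → a ≲ a′ → (λ i → b ·ℚ a i) ≲ (λ i → b ·ℚ a′ i)
≲-· true a≲a′ = a≲a′
≲-· false _ = ≡⇒≲ λ _ → refl

-- Necessity: counting the weight at T

+-cast-0 : ∀ p → p ≡ p ℚ.+ cast 0ℤ
+-cast-0 p = ≡.sym (ℚ.+-identityʳ p)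

1≡0+cast-1 : 1ℚ ≡ 0ℚ ℚ.+ cast 1ℤ
1≡0+cast-1 = refl

-- The weight at an end in T is charged to the opposite end if that lies in S. Otherwise it is at
-- most 1 and paid for by the crossing, or the edge belongs to `H` (`k` is true) and carries no
-- positive weight.
arc-bound : ∀ {w : ℕ → ℚ} → (λ _ → 0ℚ) ≲ w → w ≲ (λ _ → 1ℚ) →
  ∀ k → (k ≡ true → w ≲ (λ _ → 0ℚ)) → ∀ t s →
  (λ i → t ·ℚ w i) ≲ (λ i → s ·ℚ w i ℚ.+ cast (cross (not k) t s))
arc-bound {w} 0≲w w≲1 true w≲0 true true = ≡⇒≲ λ i → +-cast-0 (w i)
arc-bound {w} 0≲w w≲1 false w≲0 true true = ≡⇒≲ λ i → +-cast-0 (w i)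
arc-bound {w} 0≲w w≲1 true w≲0 true false = ≲-trans (w≲0 refl) (≡⇒≲ λ _ → +-cast-0 0ℚ)
arc-bound {w} 0≲w w≲1 false w≲0 true false = ≲-trans w≲1 (≡⇒≲ λ _ → 1≡0+cast-1)
arc-bound {w} 0≲w w≲1 true w≲0 false true = ≲-trans 0≲w (≡⇒≲ λ i → +-cast-0 (w i))
arc-bound {w} 0≲w w≲1 false w≲0 false true = ≲-trans 0≲w (≡⇒≲ λ i → +-cast-0 (w i))
arc-bound {w} 0≲w w≲1 true w≲0 false false = ≡⇒≲ λ _ → +-cast-0 0ℚ
arc-bound {w} 0≲w w≲1 false w≲0 false false = ≡⇒≲ λ _ → +-cast-0 0ℚ

module Necessity {G : Graph} (H : Subgraph G) where
  open Graph G
  open Excluding H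

  -- Double counting as in `∑-by-edges`, now with rational weights.
  incidence-sum : ∀ X (w : Edge → ℚ) →
    sumℚ (λ x → lookup X x ·ℚ sumℚ (λ e → lookup (edgesAt x) e ·ℚ w e)) ≡
    sumℚ (λ e → lookup X (u e) ·ℚ w e ℚ.+ lookup X (v e) ·ℚ w e)
  incidence-sum X w = begin
    sumℚ (λ x → lookup X x ·ℚ sumℚ (λ e → lookup (edgesAt x) e ·ℚ w e))
      ≡⟨ Sumsℚ.sum-cong-≗ (λ x → ≡.trans (push (lookup X x) (λ e → lookup (edgesAt x) e ·ℚ w e))
           (Sumsℚ.sum-cong-≗ λ e → ≡.trans
             (cong (λ b → lookup X x ·ℚ b ·ℚ w e) (lookup-edgesAt x e))
             (swap (lookup X x) (does (u e ≟ x) ∨ does (v e ≟ x)) (w e)))) ⟩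
    sumℚ (λ x → sumℚ (λ e → (does (u e ≟ x) ∨ does (v e ≟ x)) ·ℚ lookup X x ·ℚ w e))
      ≡⟨ Sumsℚ.∑-comm (λ x e → (does (u e ≟ x) ∨ does (v e ≟ x)) ·ℚ lookup X x ·ℚ w e) ⟩
    sumℚ (λ e → sumℚ (λ x → (does (u e ≟ x) ∨ does (v e ≟ x)) ·ℚ lookup X x ·ℚ w e))
      ≡⟨ Sumsℚ.sum-cong-≗ (λ e → Sumsℚ.sum-ends (u≢v e) (λ x → lookup X x ·ℚ w e)) ⟩
    sumℚ (λ e → lookup X (u e) ·ℚ w e ℚ.+ lookup X (v e) ·ℚ w e) ∎
    where
    open ≡.≡-Reasoning
    push : ∀ {k} b (w : Fin k → ℚ) → b ·ℚ sumℚ w ≡ sumℚ (λ e → b ·ℚ w e)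
    push true w = refl
    push {k} false w = ≡.sym (Sumsℚ.sum-replicate-zero k)
    swap : ∀ a b z → a ·ℚ b ·ℚ z ≡ b ·ℚ a ·ℚ z
    swap true b z = refl
    swap false true z = refl
    swap false false z = refl

  -- Each end of an edge was charged to the opposite end; exchanging the two charges of an edge
  -- gives the incidence sum over `S`.
  regroup : ∀ S T (z : Edge → ℚ) →
    sumℚ (λ e → (lookup S (v e) ·ℚ z e ℚ.+ cast (cross (avail e) (lookup T (u e)) (lookup S (v e))))
          ℚ.+ (lookup S (u e) ·ℚ z e ℚ.+ cast (cross (avail e) (lookup T (v e)) (lookup S (u e)))))
    ≡ sumℚ (λ x → lookup S x ·ℚ sumℚ (λ e → lookup (edgesAt x) e ·ℚ z e)) ℚ.+ cast (cut S T)
  regroup S T z = begin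
    sumℚ (λ e → (lookup S (v e) ·ℚ z e ℚ.+ cast (c₁ e)) ℚ.+ (lookup S (u e) ·ℚ z e ℚ.+ cast (c₂ e)))
      ≡⟨ Sumsℚ.sum-cong-≗ (λ e → ≡.trans
           (solve 4 (λ a b c d → (b :+ c) :+ (a :+ d) := (a :+ b) :+ (c :+ d)) refl
                  (lookup S (u e) ·ℚ z e) (lookup S (v e) ·ℚ z e) (cast (c₁ e)) (cast (c₂ e)))
           (cong (λ y → zz e ℚ.+ y) (≡.sym (cast-+ (c₁ e) (c₂ e))))) ⟩
    sumℚ (λ e → zz e ℚ.+ cast (c₁ e + c₂ e))
      ≡⟨ Sumsℚ.∑-distrib-+ zz (λ e → cast (c₁ e + c₂ e)) ⟩
    sumℚ zz ℚ.+ sumℚ (λ e → cast (c₁ e + c₂ e))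
      ≡⟨ cong₂ ℚ._+_ (≡.sym (incidence-sum S z)) (≡.sym (cast-sum (λ e → c₁ e + c₂ e))) ⟩
    sumℚ (λ x → lookup S x ·ℚ sumℚ (λ e → lookup (edgesAt x) e ·ℚ z e)) ℚ.+ cast (cut S T) ∎
    where
    open ≡.≡-Reasoning
    open ℚSolver.+-*-Solver
    c₁ c₂ : Edge → ℤ
    c₁ e = cross (avail e) (lookup T (u e)) (lookup S (v e))
    c₂ e = cross (avail e) (lookup T (v e)) (lookup S (u e))
    zz : Edge → ℚ
    zz e = lookup S (u e) ·ℚ z e ℚ.+ lookup S (v e) ·ℚ z e

  load : (Edge → ℕ → ℚ) → Vertex → ℕ → ℚ
  load w x i = sumℚ (λ e → lookup (edgesAt x) e ·ℚ w e i)

  -- The weight at `T` is r(T). Charged across edges, the part landing in `S` is at most r(S), and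
  -- the remainder is bounded by the cut.
  flow-bound : ∀ S T (r : Vertex → ℤ) (w : Edge → ℕ → ℚ) →
    (∀ x → load w x ≲ (λ _ → cast (r x)) × (λ _ → cast (r x)) ≲ load w x) →
    (∀ e a b → (λ i → lookup T a ·ℚ w e i) ≲
      (λ i → lookup S b ·ℚ w e i ℚ.+ cast (cross (avail e) (lookup T a) (lookup S b)))) →
    ∑ℤ T r ℤ.≤ ∑ℤ S r + cut S T
  flow-bound S T r w degrees arcs = cast-cancel-≲
    (≲-trans first (≲-trans second (≲-trans third (≲-trans fourth (≲-trans fifth sixth)))))
    where
    first : (λ _ → cast (∑ℤ T r)) ≲ (λ i → sumℚ (λ x → lookup T x ·ℚ load w x i))
    first = ≲-trans (≡⇒≲ λ _ → cast-∑ T r) (≲-sum λ x → ≲-· (lookup T x) (proj₂ (degrees x)))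
    second : (λ i → sumℚ (λ x → lookup T x ·ℚ load w x i)) ≲
             (λ i → sumℚ (λ e → lookup T (u e) ·ℚ w e i ℚ.+ lookup T (v e) ·ℚ w e i))
    second = ≡⇒≲ λ i → incidence-sum T (λ e → w e i)
    bound : Edge → ℕ → ℚ
    bound e i = (lookup S (v e) ·ℚ w e i ℚ.+ cast (cross (avail e) (lookup T (u e)) (lookup S (v e))))
          ℚ.+ (lookup S (u e) ·ℚ w e i ℚ.+ cast (cross (avail e) (lookup T (v e)) (lookup S (u e))))
    third : (λ i → sumℚ (λ e → lookup T (u e) ·ℚ w e i ℚ.+ lookup T (v e) ·ℚ w e i)) ≲
            (λ i → sumℚ (λ e → bound e i))
    third = ≲-sum λ e → ≲-+ (arcs e (u e) (v e)) (arcs e (v e) (u e))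
    fourth : (λ i → sumℚ (λ e → bound e i)) ≲
             (λ i → sumℚ (λ x → lookup S x ·ℚ load w x i) ℚ.+ cast (cut S T))
    fourth = ≡⇒≲ λ i → regroup S T (λ e → w e i)
    fifth : (λ i → sumℚ (λ x → lookup S x ·ℚ load w x i) ℚ.+ cast (cut S T)) ≲
            (λ _ → sumℚ (λ x → lookup S x ·ℚ cast (r x)) ℚ.+ cast (cut S T))
    fifth = ≲-+ (≲-sum λ x → ≲-· (lookup S x) (proj₁ (degrees x))) (≡⇒≲ λ _ → refl)
    sixth : (λ _ → sumℚ (λ x → lookup S x ·ℚ cast (r x)) ℚ.+ cast (cut S T)) ≲
            (λ _ → cast (∑ℤ S r + cut S T))
    sixth = ≡⇒≲ λ _ → ≡.sym (≡.trans (cast-+ (∑ℤ S r) (cut S T))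
                                     (cong (ℚ._+ cast (cut S T)) (cast-∑ S r)))

  necessity : ∀ g f → Positive g → Positive f → (∀ x → g x ℕ.≤ f x) →
    HasAllFractionalFactorsExcluding G g f H → CutCondition g f
  necessity g f g>0 f>0 g≤f hasAll S T disj =
    -- As `T` misses `S`, r(T) = f(T) and r(S) = g(S).
    ≡.subst₂ (λ a b → a ℤ.≤ b + cut S T) (sum-cong-≗ outside) (sum-cong-≗ inside)
      (flow-bound S T (λ x → + r x) w degrees end)
    where
    r : Vertex → ℕ
    r x = if lookup S x then g x else f x
    cases : (P : Vertex → ℕ → Set) → (∀ x → P x (g x)) → (∀ x → P x (f x)) → ∀ x → P x (r x)
    cases P Pg Pf x with lookup S x
    ... | true = Pg x
    ... | false = Pf x
    hasFactor = hasAll r (cases (λ _ k → 0 ℕ.< k) g>0 f>0)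
      (cases (λ x k → g x ℕ.≤ k × k ℕ.≤ f x) (λ x → ℕ.≤-refl , g≤f x) (λ x → g≤f x , ℕ.≤-refl))
    open FractionalFactor (proj₁ hasFactor)
    w : Edge → ℕ → ℚ
    w e = seq (h e)
    degrees : ∀ x → load w x ≲ (λ _ → cast (+ r x)) × (λ _ → cast (+ r x)) ≲ load w x
    degrees x = ≲-trans (≡⇒≲ λ i → ≡.sym (seq-∑ℝ (edgesAt x) h i)) (proj₁ both) ,
                ≲-trans (proj₂ both) (≡⇒≲ λ i → seq-∑ℝ (edgesAt x) h i)
      where
      both : seq (∑ℝ (edgesAt x) h) ≲ (λ _ → cast (+ r x)) ×
             (λ _ → cast (+ r x)) ≲ seq (∑ℝ (edgesAt x) h)
      both = ≈ᴿ⇒≲ {∑ℝ (edgesAt x) h} {fromℕ (r x)} (sum≈r x)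
    end : ∀ e a b → (λ i → lookup T a ·ℚ w e i) ≲
          (λ i → lookup S b ·ℚ w e i ℚ.+ cast (cross (avail e) (lookup T a) (lookup S b)))
    end e a b = arc-bound (mk≲ (0≤h e)) (mk≲ (h≤1 e)) (inH e)
      -- A positive weight on an edge of `H` would put the edge into the support, which the factor
      -- excludes.
      (λ e∈H → ≮0⇒≲0 (h e) λ 0<h → proj₂ hasFactor e (lookup⇒[]= e (Subgraph.edges H) e∈H , 0<h))
      (lookup T a) (lookup S b)
    outside : ∀ x → lookup T x · (+ r x) ≡ lookup T x · (+ f x)
    outside x with lookup S x | lookup T x | disj x
    ... | false | _ | _ = refl
    ... | true | false | _ = refl
    inside : ∀ x → lookup S x · (+ r x) ≡ lookup S x · (+ g x)
    inside x with lookup S x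
    ... | true = refl
    ... | false = refl

-- Sufficiency: a half-integral factor from the two arcs of each edge

halve : ℤ → ℚ
halve z = ½ ℚ.* cast z

halve-sum : ∀ {n} (φ : Fin n → ℤ) → sumℚ (halve ∘ φ) ≡ halve (sum φ)
halve-sum {zero} φ = refl
halve-sum {suc n} φ = begin
  halve (φ zero) ℚ.+ sumℚ (halve ∘ φ ∘ suc)
    ≡⟨ cong (λ z → halve (φ zero) ℚ.+ z) (halve-sum (φ ∘ suc)) ⟩
  halve (φ zero) ℚ.+ halve (sum (φ ∘ suc))
    ≡⟨ ℚ.*-distribˡ-+ ½ (cast (φ zero)) (cast (sum (φ ∘ suc))) ⟨
  ½ ℚ.* (cast (φ zero) ℚ.+ cast (sum (φ ∘ suc)))
    ≡⟨ cong (½ ℚ.*_) (cast-+ (φ zero) (sum (φ ∘ suc))) ⟨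
  halve (φ zero + sum (φ ∘ suc)) ∎
  where open ≡.≡-Reasoning

halve-double : ∀ z → halve (z + z) ≡ cast z
halve-double z = ≡.trans (cong (½ ℚ.*_) (cast-+ z z))
  (≡.trans (ℚ.*-distribˡ-+ ½ (cast z) (cast z)) (½+½ (cast z)))

fromℚ-mono : ∀ {p q} → p ℚ.≤ q → fromℚ p ≤ᴿ fromℚ q
fromℚ-mono {p} {q} p≤q = eventually (≤⇒≲ {λ _ → p} {λ _ → q} λ _ → p≤q)

halve-bounds : ∀ a b → 0ℚ ℚ.≤ halve (ι a + ι b) × halve (ι a + ι b) ℚ.≤ 1ℚ
halve-bounds = λ a b → lower-bound a b , upper-bound a b
  where
  lower-bound : ∀ a b → 0ℚ ℚ.≤ halve (ι a + ι b)
  lower-bound = from-yes (allBool? λ a → allBool? λ b → 0ℚ ℚ.≤? halve (ι a + ι b))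
  upper-bound : ∀ a b → halve (ι a + ι b) ℚ.≤ 1ℚ
  upper-bound = from-yes (allBool? λ a → allBool? λ b → halve (ι a + ι b) ℚ.≤? 1ℚ)

module Sufficiency {G : Graph} (H : Subgraph G) where
  open Graph G
  open Excluding H

  -- The first block directs every edge from `u` to `v`, the second block from `v` to `u`; both arcs
  -- are usable exactly when the edge is not in `H`.
  doubleCover : Arcs order (size ℕ.+ size)
  doubleCover = record
    { usable = avail F.++ avail
    ; tail   = u F.++ v
    ; head   = v F.++ u
    }

  sum-++ : ∀ {m n} {A B C : Set} (F : A → B → C → ℤ)
    (a₁ : Fin m → A) (a₂ : Fin n → A) (b₁ : Fin m → B) (b₂ : Fin n → B)
    (c₁ : Fin m → C) (c₂ : Fin n → C) →
    sum (λ i → F ((a₁ F.++ a₂) i) ((b₁ F.++ b₂) i) ((c₁ F.++ c₂) i)) ≡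
    sum (λ i → F (a₁ i) (b₁ i) (c₁ i)) + sum (λ i → F (a₂ i) (b₂ i) (c₂ i))
  sum-++ {m} {n} F a₁ a₂ b₁ b₂ c₁ c₂ = ≡.trans
    (sum-↑ m (λ i → F ((a₁ F.++ a₂) i) ((b₁ F.++ b₂) i) ((c₁ F.++ c₂) i)))
    (cong₂ _+_ (sum-cong-≗ left) (sum-cong-≗ right))
    where
    left : ∀ i → F ((a₁ F.++ a₂) (i ↑ˡ n)) ((b₁ F.++ b₂) (i ↑ˡ n)) ((c₁ F.++ c₂) (i ↑ˡ n))
                 ≡ F (a₁ i) (b₁ i) (c₁ i)
    left i rewrite lookup-++ˡ a₁ a₂ i | lookup-++ˡ b₁ b₂ i | lookup-++ˡ c₁ c₂ i = refl
    right : ∀ i → F ((a₁ F.++ a₂) (m ↑ʳ i)) ((b₁ F.++ b₂) (m ↑ʳ i)) ((c₁ F.++ c₂) (m ↑ʳ i))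
                  ≡ F (a₂ i) (b₂ i) (c₂ i)
    right i rewrite lookup-++ʳ a₁ a₂ i | lookup-++ʳ b₁ b₂ i | lookup-++ʳ c₁ c₂ i = refl

  -- The tail set plays the role of T and the head set that of S, hence the exchanged arguments of
  -- `cut`.
  crossing-doubleCover : ∀ X Y → sum (crossing doubleCover X Y) ≡ cut Y X
  crossing-doubleCover X Y = ≡.trans
    (sum-++ (λ a t h → cross a (lookup X t) (lookup Y h)) avail avail u v v u)
    (≡.sym (∑-distrib-+ (λ e → cross (avail e) (lookup X (u e)) (lookup Y (v e)))
                        (λ e → cross (avail e) (lookup X (v e)) (lookup Y (u e)))))

  -- An arc from T outside S into S ∩ T crosses only the new cut, but its reverse crosses only the
  -- old one. Every other arc of the new cut is in the old cut too, so having both directions of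
  -- each edge makes the bound work.
  cut-uncross : ∀ S T → cut (S ∩ ∁ T) (T ∩ ∁ S) ℤ.≤ cut S T
  cut-uncross S T = sum-mono-≤ edge
    where
    table : ∀ k su sv tu tv →
      cross k (tu ∧ not su) (sv ∧ not tv) + cross k (tv ∧ not sv) (su ∧ not tu) ℤ.≤
      cross k tu sv + cross k tv su
    table = from-yes (allBool? λ k → allBool? λ su → allBool? λ sv → allBool? λ tu → allBool? λ tv →
      cross k (tu ∧ not su) (sv ∧ not tv) + cross k (tv ∧ not sv) (su ∧ not tu) ℤ.≤?
      cross k tu sv + cross k tv su)
    edge : ∀ e →
      cross (avail e) (lookup (T ∩ ∁ S) (u e)) (lookup (S ∩ ∁ T) (v e)) +
      cross (avail e) (lookup (T ∩ ∁ S) (v e)) (lookup (S ∩ ∁ T) (u e)) ℤ.≤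
      cross (avail e) (lookup T (u e)) (lookup S (v e)) +
      cross (avail e) (lookup T (v e)) (lookup S (u e))
    edge e rewrite lookup-∩∁ T S (u e) | lookup-∩∁ T S (v e)
                 | lookup-∩∁ S T (u e) | lookup-∩∁ S T (v e) =
      table (avail e) (lookup S (u e)) (lookup S (v e)) (lookup T (u e)) (lookup T (v e))

  module _ {g f r : Vertex → ℕ} (g≤r≤f : ∀ x → g x ℕ.≤ r x × r x ℕ.≤ f x)
           (cond : CutCondition g f) where

    private
      p : Vertex → ℤ
      p x = + r x

    -- On `T` the demand is at most `f`, and on `S` it is at least `g`.
    disjoint-bound : ∀ S T → Disjoint S T → ∑ℤ T p ℤ.≤ ∑ℤ S p + cut S T
    disjoint-bound S T disj = begin
      ∑ℤ T p
        ≤⟨ sum-mono-≤ (λ x → ·-mono (lookup T x) (ℤ.+≤+ (proj₂ (g≤r≤f x)))) ⟩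
      ∑ℤ T (λ x → + f x)
        ≤⟨ cond S T disj ⟩
      ∑ℤ S (λ x → + g x) + cut S T
        ≤⟨ ℤ.+-monoˡ-≤ (cut S T)
             (sum-mono-≤ λ x → ·-mono (lookup S x) (ℤ.+≤+ (proj₁ (g≤r≤f x)))) ⟩
      ∑ℤ S p + cut S T ∎
      where
      open ℤ.≤-Reasoning
      ·-mono : ∀ b {i j} → i ℤ.≤ j → b · i ℤ.≤ b · j
      ·-mono true i≤j = i≤j
      ·-mono false _ = ℤ.≤-refl

    doubleCover-feasible : Feasible doubleCover p p
    doubleCover-feasible T S = begin
      ∑ℤ T p - ∑ℤ S p - sum (crossing doubleCover T S)
        ≡⟨ cong₂ _-_ difference (crossing-doubleCover T S) ⟩
      ∑ℤ T′ p - ∑ℤ S′ p - cut S T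
        ≤⟨ ℤ.+-monoʳ-≤ (∑ℤ T′ p - ∑ℤ S′ p) (ℤ.neg-mono-≤ (cut-uncross S T)) ⟩
      ∑ℤ T′ p - ∑ℤ S′ p - cut S′ T′
        ≡⟨ solve 3 (λ a b c → a :- b :- c := a :- (b :+ c)) refl (∑ℤ T′ p) (∑ℤ S′ p) (cut S′ T′) ⟩
      ∑ℤ T′ p - (∑ℤ S′ p + cut S′ T′)
        ≤⟨ ℤ.i≤j⇒i-j≤0 (disjoint-bound S′ T′ disj) ⟩
      0ℤ ∎
      where
      open ℤ.≤-Reasoning
      open +-*-Solver
      S′ T′ : Subset order
      S′ = S ∩ ∁ T
      T′ = T ∩ ∁ S
      disj : Disjoint S′ T′
      disj x rewrite lookup-∩∁ S T x | lookup-∩∁ T S x with lookup S x | lookup T x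
      ... | false | _ = refl
      ... | true | false = refl
      ... | true | true = refl
      -- Out-demand and in-demand are the same function, so the vertices of S ∩ T cancel.
      difference : ∑ℤ T p - ∑ℤ S p ≡ ∑ℤ T′ p - ∑ℤ S′ p
      difference = ≡.trans (expand T S) (≡.trans (sum-cong-≗ pointwise) (≡.sym (expand T′ S′)))
        where
        expand : ∀ X Y → ∑ℤ X p - ∑ℤ Y p ≡ sum (λ x → lookup X x · p x - lookup Y x · p x)
        expand X Y = ≡.trans (cong (λ z → ∑ℤ X p + z) (≡.sym (sum-neg (λ x → lookup Y x · p x))))
          (≡.sym (∑-distrib-+ (λ x → lookup X x · p x) (λ x → ℤ.- (lookup Y x · p x))))
        pointwise : ∀ x → lookup T x · p x - lookup S x · p x ≡
                          lookup T′ x · p x - lookup S′ x · p x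
        pointwise x rewrite lookup-∩∁ S T x | lookup-∩∁ T S x with lookup S x | lookup T x
        ... | false | false = refl
        ... | false | true = refl
        ... | true | false = refl
        ... | true | true = ℤ.+-inverseʳ (p x)

    private
      σ : Selection doubleCover p p
      σ = feasible⇒selection doubleCover p p refl doubleCover-feasible

      -- `φ` records whether the arc from `u e` to `v e` is chosen, `ψ` whether its reverse is.
      φ ψ : Edge → Bool
      φ e = chosen σ (e ↑ˡ size)
      ψ e = chosen σ (size ↑ʳ e)

      weight : Edge → ℤ
      weight e = ι (φ e) + ι (ψ e)

    -- A chosen arc of an edge at `x` either leaves or enters `x`, and r(x) arcs do each. Hence the
    -- weights are halved in the factor.
    weight-degree : ∀ x → ∑ℤ (edgesAt x) weight ≡ p x + p x
    weight-degree x = begin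
      ∑ℤ (edgesAt x) weight
        ≡⟨ sum-cong-≗ (λ e → ≡.trans (cong (_· weight e) (lookup-edgesAt x e))
             (split (u e ≟ x) (v e ≟ x) (u≢v e) (φ e) (ψ e))) ⟩
      sum (λ e → (α e + β e) + (γ e + δ e))
        ≡⟨ ∑-distrib-+ (λ e → α e + β e) (λ e → γ e + δ e) ⟩
      sum (λ e → α e + β e) + sum (λ e → γ e + δ e)
        ≡⟨ cong₂ _+_ (∑-distrib-+ α β) (∑-distrib-+ γ δ) ⟩
      (sum α + sum β) + (sum γ + sum δ)
        ≡⟨ cong₂ _+_ (≡.trans (≡.sym (outgoing u v)) (out σ x))
                     (≡.trans (≡.sym (outgoing v u)) (into σ x)) ⟩
      p x + p x ∎
      where
      open ≡.≡-Reasoning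
      -- `α` and `β` collect the chosen arcs leaving `x`, `γ` and `δ` those entering it; heads arise
      -- from tails by exchanging `u` and `v`.
      α β γ δ : Edge → ℤ
      α e = ι (does (u e ≟ x) ∧ φ e)
      β e = ι (does (v e ≟ x) ∧ ψ e)
      γ e = ι (does (v e ≟ x) ∧ φ e)
      δ e = ι (does (u e ≟ x) ∧ ψ e)
      outgoing : ∀ (s t : Edge → Vertex) →
        sum (λ a → ι (does ((s F.++ t) a ≟ x) ∧ chosen σ a)) ≡
        sum (λ e → ι (does (s e ≟ x) ∧ φ e)) + sum (λ e → ι (does (t e ≟ x) ∧ ψ e))
      outgoing s t = ≡.trans (sum-↑ size (λ a → ι (does ((s F.++ t) a ≟ x) ∧ chosen σ a)))
        (cong₂ _+_
          (sum-cong-≗ λ e → cong (λ y → ι (does (y ≟ x) ∧ φ e)) (lookup-++ˡ s t e))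
          (sum-cong-≗ λ e → cong (λ y → ι (does (y ≟ x) ∧ ψ e)) (lookup-++ʳ s t e)))
      split : ∀ {a b} (a? : Dec (a ≡ x)) (b? : Dec (b ≡ x)) → a ≢ b → ∀ k l →
        (does a? ∨ does b?) · (ι k + ι l) ≡
        (ι (does a? ∧ k) + ι (does b? ∧ l)) + (ι (does b? ∧ k) + ι (does a? ∧ l))
      split (yes refl) (yes refl) a≢b k l = contradiction refl a≢b
      split (no _) (no _) _ k l = refl
      split (yes _) (no _) _ k l = cong₂ _+_ (≡.sym (ℤ.+-identityʳ (ι k))) (≡.sym (ℤ.+-identityˡ (ι l)))
      split (no _) (yes _) _ k l = ≡.trans (ℤ.+-comm (ι k) (ι l))
        (cong₂ _+_ (≡.sym (ℤ.+-identityˡ (ι l))) (≡.sym (ℤ.+-identityʳ (ι k))))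

    factor : FractionalFactor G r
    factor .FractionalFactor.h e = fromℚ (halve (weight e))
    factor .FractionalFactor.0≤h e = fromℚ-mono (proj₁ (halve-bounds (φ e) (ψ e)))
    factor .FractionalFactor.h≤1 e = fromℚ-mono (proj₂ (halve-bounds (φ e) (ψ e)))
    -- The weights are constant sequences and their sum is exactly r(x), so 0 serves as the
    -- threshold for every ε.
    factor .FractionalFactor.sum≈r x ε 0<ε = 0 , λ i _ → ≡.subst (ℚ._< ε)
      (≡.sym (≡.trans (cong (λ z → ℚ.∣ z ℚ.- cast (p x) ∣) (total i))
                      (cong ℚ.∣_∣ (ℚ.+-inverseʳ (cast (p x)))))) 0<ε
      where
      total : ∀ i → seq (∑ℝ (edgesAt x) (λ e → fromℚ (halve (weight e)))) i ≡ cast (p x)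
      total i = begin
        seq (∑ℝ (edgesAt x) (λ e → fromℚ (halve (weight e)))) i
          ≡⟨ seq-∑ℝ (edgesAt x) (λ e → fromℚ (halve (weight e))) i ⟩
        sumℚ (λ e → lookup (edgesAt x) e ·ℚ halve (weight e))
          ≡⟨ Sumsℚ.sum-cong-≗ (λ e → Bool.if-float halve (lookup (edgesAt x) e)) ⟨
        sumℚ (λ e → halve (lookup (edgesAt x) e · weight e))
          ≡⟨ halve-sum (λ e → lookup (edgesAt x) e · weight e) ⟩
        halve (∑ℤ (edgesAt x) weight)
          ≡⟨ cong halve (weight-degree x) ⟩
        halve (p x + p x)
          ≡⟨ halve-double (p x) ⟩
        cast (p x) ∎
        where open ≡.≡-Reasoning

    weight-H : ∀ e → inH e ≡ true → weight e ≡ 0ℤ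
    weight-H e e∈H = cong₂ (λ a b → ι a + ι b)
      (allowed σ (e ↑ˡ size) (≡.trans (lookup-++ˡ avail avail e) (cong not e∈H)))
      (allowed σ (size ↑ʳ e) (≡.trans (lookup-++ʳ avail avail e) (cong not e∈H)))

    factor-excludes : ∀ e → ¬ (e ∈ Subgraph.edges H × FractionalFactor.support factor e)
    -- On an edge of `H` neither arc is usable and the weight is constantly 0, so a positive gap
    -- would give ε < 0.
    factor-excludes e (e∈H , ε , 0<ε , N , gap) = ℚ.<-asym 0<ε
      (≡.subst₂ ℚ._<_ (ℚ.+-identityˡ ε) (cong halve (weight-H e ([]=⇒lookup e∈H))) (gap N ℕ.≤-refl))

  sufficiency : ∀ g f → CutCondition g f → HasAllFractionalFactorsExcluding G g f H
  sufficiency g f cond r _ g≤r≤f = factor g≤r≤f cond , factor-excludes g≤r≤f cond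

theorem5 : (G : Graph) (g f : Graph.Vertex G → ℕ) →
    Positive g → Positive f → (∀ x → g x ≤ f x) →
    (H : Subgraph G) →
    HasAllFractionalFactorsExcluding G g f H ⇔
    ((S : Subset (Graph.order G)) →
    let T = deficientSet G f H S in
    (∑[ x ∈ S ] (+ g x)) + (∑[ x ∈ T ] (+ degree (G ∖ S) x)) - (∑[ x ∈ T ] (+ f x))
    ≥ (∑[ x ∈ T ] (+ degree H x)) - + between H S T)
theorem5 G g f g>0 f>0 g≤f H = mk⇔
  (λ hasAll → cutCondition⇒condition g f (necessity g f g>0 f>0 g≤f hasAll))
  (λ condition → sufficiency g f (condition⇒cutCondition g f condition))
  where
  open Excluding H
  open Necessity H
  open Sufficiency H
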